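{- Let $(G,\chi_V,\chi_E)$ be a vertex- and arc-colored graph (with arbitrary colorings) such that $G$ excludes $K_h$ as a topological subgraph, and let $X\subseteq V(G)$. Let $t\ge 3h^3$ and $D:=\mathrm{cl}_t^{G}(X)$. Then for the vertex set $Z$ of any connected component of $G-D$, we have $|N_G(Z)|<h$.
   Context: Graphs are finite, simple, undirected. $N_G(Z)=(\bigcup_{v\in Z}N_G(v))\setminus Z$. $H$ is a topological subgraph of $G$ if some subdivision of $H$ (each edge replaced by a path of length $\ge1$) is a subgraph of $G$. A vertex-coloring $\chi_V$ assigns colors to vertices; an arc-coloring $\chi_E$ assigns colors to ordered pairs $(u,v)$ with $uv\in E(G)$. For a vertex-coloring $\chi$, $[v]_\chi=\{w\mid \chi(w)=\chi(v)\}$. Color Refinement: given $(G,\chi,\chi_E)$ set $\chi^{(0)}=\chi$ and $\chi^{(i+1)}(v)=(\chi^{(i)}(v),\{\!\{(\chi^{(i)}(w),\chi_E(v,w),\chi_E(w,v))\mid w\in N_G(v)\}\!\})$; the stable coloring $\mathrm{WL}_1(G,\chi,\chi_E)$ is $\chi^{(i)}$ for the least $i$ such that $\chi^{(i+1)}$ induces the same partition as $\chi^{(i)}$. Closure: define $\chi_0(v)=(v,1)$ if $v\in X$ and $(\chi_V(v),0)$ otherwise; $\chi_{2i+1}=\mathrm{WL}_1(G,\chi_{2i},\chi_E)$; $\chi_{2i+2}(v)=(v,1)$ if $|[v]_{\chi_{2i+1}}|\le t$ and $(\chi_{2i+1}(v),0)$ otherwise. Let $i^*$ be minimal such that $\chi_{i^*}$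 and $\chi_{i^*+1}$ induce the same partition. Then $\mathrm{cl}_t^{G}(X)=\mathrm{cl}_t^{(G,\chi_V,\chi_E)}(X):=\{v\in V(G)\mid |[v]_{\chi_{i^*}}|=1\}$.
   Formalization: The index i* is taken as one from which the partitions induced by χ_j stay constant, not the minimal i with χ_i and χ_{i+1} inducing the same partition; with the latter the claim fails (K_{4,2}, h=4, X the 4-side, uniform colors: i*=0). -}

module Defs where

open import Data.Nat.Base using (ℕ; zero; suc; _+_; _*_; _≡ᵇ_; _≤ᵇ_; _<_; _≤_)
open import Data.Bool.Base using (Bool; true; false; _∧_; _∨_; not; T; if_then_else_)
open import Data.Fin.Base using (Fin; inject₁; fromℕ) renaming (zero to fz; suc to fs; _<_ to _<ᶠ_)
open import Data.Fin.Properties using (_≟_)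
open import Data.Product.Base using (Σ; _×_; _,_)
open import Data.Sum.Base using (_⊎_)
open import Relation.Nullary.Decidable using (⌊_⌋)
open import Relation.Nullary.Negation using (¬_)
open import Relation.Binary.PropositionalEquality using (_≡_; _≢_)

record Graph (n : ℕ) : Set where
  field
    adj    : Fin n → Fin n → Bool
    sym    : ∀ u v → adj u v ≡ adj v u
    irrefl : ∀ v → adj v v ≡ false
open Graph public

Subset : ℕ → Set
Subset n = Fin n → Bool

count : ∀ {n} → (Fin n → Bool) → ℕ
count {zero}  p = 0
count {suc n} p = (if p fz then 1 else 0) + count (λ i → p (fs i))

allV : ∀ {n} → (Fin n → Bool) → Bool
allV {zero}  p = true
allV {suc n} p = p fz ∧ allV (λ i → p (fs i))

anyV : ∀ {n} → (Fin n → Bool) → Bool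
anyV {zero}  p = false
anyV {suc n} p = p fz ∨ anyV (λ i → p (fs i))

eqV : ∀ {n} → Fin n → Fin n → Bool
eqV v w = ⌊ v ≟ w ⌋

eqB : Bool → Bool → Bool
eqB true  b = b
eqB false b = not b

-- Colorings, represented by the partition they induce:
-- R v w = true  iff  v and w receive the same color.
-- (Color Refinement and the closure only ever compare colors for
-- equality, so everything is determined by the induced partitions.)

Coloring : ℕ → Set
Coloring n = Fin n → Fin n → Bool

samePart : ∀ {n} → Coloring n → Coloring n → Bool
samePart R S = allV (λ v → allV (λ w → eqB (R v w) (S v w)))

classSize : ∀ {n} → Coloring n → Fin n → ℕ
classSize R v = count (λ w → R v w)

-- One round of Color Refinement w.r.t. the arc-coloring χE:
-- χ'(v) = χ'(w) iff χ(v) = χ(w) and the multisets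
-- {{(χ(u), χE(v,u), χE(u,v)) | u ∈ N(v)}} and the one for w coincide.
-- Multiset equality is expressed by equal multiplicities of every triple
-- (color of x, χE(p,q), χE(r,s)); all other triples have multiplicity 0
-- on both sides.
mult : ∀ {n} → Graph n → (Fin n → Fin n → ℕ) → Coloring n →
       Fin n → Fin n → Fin n → Fin n → Fin n → Fin n → ℕ
mult G χE R v x p q r s =
  count (λ u → adj G v u ∧ R u x ∧ (χE v u ≡ᵇ χE p q) ∧ (χE u v ≡ᵇ χE r s))

refine : ∀ {n} → Graph n → (Fin n → Fin n → ℕ) → Coloring n → Coloring n
refine G χE R v w =
  R v w ∧ allV (λ x → allV (λ p → allV (λ q → allV (λ r → allV (λ s →
    mult G χE R v x p q r s ≡ᵇ mult G χE R w x p q r s)))))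

refIter : ∀ {n} → Graph n → (Fin n → Fin n → ℕ) → ℕ → Coloring n → Coloring n
refIter G χE zero    R = R
refIter G χE (suc i) R = refine G χE (refIter G χE i R)

IsWL1 : ∀ {n} → Graph n → (Fin n → Fin n → ℕ) → Coloring n → Coloring n → Set
IsWL1 G χE R S =
  Σ ℕ λ i →
    (samePart (refIter G χE i R) (refIter G χE (suc i) R) ≡ true) ×
    (∀ j → j < i → samePart (refIter G χE j R) (refIter G χE (suc j) R) ≡ false) ×
    (∀ v w → S v w ≡ refIter G χE i R v w)

-- χ(v) = (v,1) if v ∈ Y, and (ψ(v),0) otherwise  (ψ given as a partition)
individualize : ∀ {n} → Subset n → Coloring n → Coloring n
individualize Y ψ v w =
  (Y v ∧ Y w ∧ eqV v w) ∨ (not (Y v) ∧ not (Y w) ∧ ψ v w)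

vertexColoring : ∀ {n} → (Fin n → ℕ) → Coloring n
vertexColoring χV v w = χV v ≡ᵇ χV w

smallClass : ∀ {n} → ℕ → Coloring n → Subset n
smallClass t R v = classSize R v ≤ᵇ t

IsClosureSeq : ∀ {n} → Graph n → (Fin n → ℕ) → (Fin n → Fin n → ℕ) →
               Subset n → ℕ → (ℕ → Coloring n) → Set
IsClosureSeq G χV χE X t c =
  (∀ v w → c 0 v w ≡ individualize X (vertexColoring χV) v w) ×
  (∀ i → IsWL1 G χE (c (2 * i)) (c (suc (2 * i)))) ×
  (∀ i v w → c (suc (suc (2 * i))) v w
             ≡ individualize (smallClass t (c (suc (2 * i)))) (c (suc (2 * i))) v w)

IsStableIndex : ∀ {n} → (ℕ → Coloring n) → ℕ → Set
IsStableIndex c i = ∀ j → i ≤ j → samePart (c i) (c j) ≡ true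

singletons : ∀ {n} → Coloring n → Subset n
singletons R v = classSize R v ≡ᵇ 1

record TopKSub {n} (G : Graph n) (h : ℕ) : Set where
  field
    branch     : Fin h → Fin n
    branch-inj : ∀ i j → branch i ≡ branch j → i ≡ j
    len        : Fin h → Fin h → ℕ
    path       : (i j : Fin h) → Fin (suc (len i j)) → Fin n
    path-start : ∀ i j → i <ᶠ j → path i j fz ≡ branch i
    path-end   : ∀ i j → i <ᶠ j → path i j (fromℕ (len i j)) ≡ branch j
    path-edge  : ∀ i j → i <ᶠ j → (k : Fin (len i j)) →
                 adj G (path i j (inject₁ k)) (path i j (fs k)) ≡ true
    path-inj   : ∀ i j → i <ᶠ j → ∀ k l → path i j k ≡ path i j l → k ≡ l
    path-branch : ∀ i j → i <ᶠ j → ∀ k l → path i j k ≡ branch l → (l ≡ i) ⊎ (l ≡ j)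
    path-disj  : ∀ i j i' j' → i <ᶠ j → i' <ᶠ j' → ¬ ((i ≡ i') × (j ≡ j')) →
                 ∀ k k' → path i j k ≡ path i' j' k' →
                 Σ (Fin h) λ l → path i j k ≡ branch l

data Reach {n} (G : Graph n) (S : Subset n) : Fin n → Fin n → Set where
  here : ∀ {v} → Reach G S v v
  step : ∀ {u w v} → adj G u w ≡ true → S w ≡ true → Reach G S w v → Reach G S u v

IsComponent : ∀ {n} → Graph n → Subset n → Subset n → Set
IsComponent G D Z =
  (Σ _ λ v → Z v ≡ true) ×
  (∀ v → Z v ≡ true → D v ≡ false) ×
  (∀ u v → Z u ≡ true → Z v ≡ true → Reach G Z u v) ×
  (∀ u v → Z u ≡ true → adj G u v ≡ true → D v ≡ false → Z v ≡ true)

nbhd : ∀ {n} → Graph n → Subset n → Subset n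
nbhd G Z v = not (Z v) ∧ anyV (λ u → Z u ∧ adj G u v)

{-# OPTIONS --safe #-}
module Submission where

open import Algebra.Properties.CommutativeSemigroup using (interchange)
import Algebra.Properties.CommutativeSemigroup as CommutativeSemigroup
open import Data.Bool.Base using (Bool; true; false; _∧_; _∨_; not; if_then_else_; T)
open import Data.Bool.Properties using (∨-zeroʳ; ∧-comm) renaming (_≟_ to _≟ᵇ_)
open import Data.Empty using (⊥; ⊥-elim)
open import Data.Fin.Base using (Fin; zero; suc; toℕ; fromℕ; inject₁; inject≤; combine)
  renaming (_<_ to _<ᶠ_)
open import Data.Fin.Properties using (_≟_; any?; inject≤-injective; combine-injective)
open import Data.List.Base
  using (List; []; _∷_; _++_; map; length; filter; concatMap; allFin; lookup; tabulate)
open import Data.List.Properties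
  using (map-++; ++-identityʳ; map-∘; map-id; length-++; length-map; ++-assoc; map-tabulate)
import Data.List.Membership.DecPropositional as DecMembership
open import Data.List.Membership.Propositional using (_∈_; _∉_)
open import Data.List.Membership.Propositional.Properties
  using (∈-∃++; ∈-++⁻; ∈-++⁺ˡ; ∈-++⁺ʳ; ∈-filter⁺; ∈-filter⁻; ∈-allFin; ∈-map⁺; ∈-map⁻)
open import Data.List.Relation.Binary.Disjoint.Propositional using (Disjoint)
open import Data.List.Relation.Binary.Permutation.Propositional
  using (_↭_; refl; prep; swap; ↭-sym; ↭-trans; ↭-reflexive; ↭⇒↭ₛ; module PermutationReasoning)
import Data.List.Relation.Binary.Permutation.Propositional.Properties as Perm
import Data.List.Relation.Binary.Permutation.Setoid.Properties as PermS
open import Data.List.Relation.Unary.All as All using (All; []; _∷_)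
import Data.List.Relation.Unary.All.Properties as All
open import Data.List.Relation.Unary.AllPairs using ([]; _∷_)
open import Data.List.Relation.Unary.Any using (here; there)
open import Data.List.Relation.Unary.Unique.Propositional using (Unique)
import Data.List.Relation.Unary.Unique.Propositional.Properties as Unique
open import Data.Nat.Base
open import Data.Nat.ListAction using (sum)
open import Data.Nat.ListAction.Properties using (sum-++; sum-↭)
open import Data.Nat.Properties hiding (_≟_)
open import Data.Product.Base using (Σ; Σ-syntax; ∃; ∃₂; _×_; _,_; proj₁; proj₂)
open import Data.Sum.Base using (_⊎_; inj₁; inj₂)
open import Data.Unit.Base using (⊤; tt)
open import Function.Base using (_∘_; flip; id)
open import Relation.Binary.Construct.Closure.ReflexiveTransitive
  using (Star; ε; _◅_; _◅◅_) renaming (gmap to Star-gmap)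
open import Relation.Binary.Definitions using () renaming (Decidable to Decidable₂)
open import Relation.Binary.PropositionalEquality
  using (_≡_; _≢_; cong; cong₂; subst; setoid; module ≡-Reasoning)
  renaming (refl to ≡-refl; sym to ≡-sym; trans to ≡-trans)
open import Relation.Nullary using (¬_; Dec; yes; no; contradiction)
open import Relation.Nullary.Decidable using (⌊_⌋; _×-dec_; _⊎-dec_)
open import Relation.Unary using (Decidable)
open import Defs

-- Colour classes of the stable colouring are singletons or have more than t elements, and between
-- adjacent classes c, d the edges with a fixed pair of arc colours are biregular, so that every
-- X ⊆ c satisfies |N(X) ∩ d| / |d| ≥ |X| / |c|.  Suppose N(Z) contains h vertices vᵢ.  Each vᵢ is a
-- singleton class and is therefore complete to some class Aᵢ meeting Z.  Join the Aᵢ by a tree of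
-- classes; suppressing its vertices of degree two leaves at most 3h segments and leaves.  While
-- fewer than h² disjoint subtrees of G following this tree have been found, one more can be added:
-- going from the leaves to the root, an augmenting-path argument on each segment shows that the
-- fraction of a class at which no new subtree can be rooted grows by at most k/(t + 1) per segment
-- or leaf, where k is the current number of subtrees, and 3h · k < 3h³ ≤ t.  The h² disjoint
-- subtrees each contain a neighbour of every vᵢ, and using a different one for each pair (i, j)
-- produces a subdivision of K_h.

-- Booleans, sums and counting over lists.

private
  variable
    A B : Set

sound : {P : Set} (P? : Dec P) → ⌊ P? ⌋ ≡ true → P
sound (yes p) _ = p

complete : {P : Set} (P? : Dec P) → P → ⌊ P? ⌋ ≡ true
complete (yes _) _ = ≡-refl
complete (no ¬p) p = contradiction p ¬p

∧-true : ∀ {a b} → a ∧ b ≡ true → a ≡ true × b ≡ true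
∧-true {true} b≡true = ≡-refl , b≡true

∨-introˡ : ∀ {a b} → a ≡ true → a ∨ b ≡ true
∨-introˡ ≡-refl = ≡-refl

∨-introʳ : ∀ a {b} → b ≡ true → a ∨ b ≡ true
∨-introʳ a ≡-refl = ∨-zeroʳ a

true-or-false : (b : Bool) → b ≡ true ⊎ b ≡ false
true-or-false true  = inj₁ ≡-refl
true-or-false false = inj₂ ≡-refl

not-true : ∀ {b} → not b ≡ true → b ≡ false
not-true {false} _ = ≡-refl

false≢true : ∀ {b} → b ≡ false → b ≡ true → ⊥
false≢true ≡-refl ()

unique-↭ : {xs ys : List A} → xs ↭ ys → Unique xs → Unique ys
unique-↭ {A = A} p = PermS.Unique-resp-↭ (setoid A) (↭⇒↭ₛ p)

ind : Bool → ℕ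
ind b = if b then 1 else 0

ind-mono : ∀ {a b} → (a ≡ true → b ≡ true) → ind a ≤ ind b
ind-mono {false} _ = z≤n
ind-mono {true}  f rewrite f ≡-refl = ≤-refl

∑ : List A → (A → ℕ) → ℕ
∑ xs f = sum (map f xs)

∑-mono : (xs : List A) {f g : A → ℕ} → (∀ {x} → x ∈ xs → f x ≤ g x) → ∑ xs f ≤ ∑ xs g
∑-mono []       _   = z≤n
∑-mono (x ∷ xs) f≤g = +-mono-≤ (f≤g (here ≡-refl)) (∑-mono xs (f≤g ∘ there))

∑-+ : (xs : List A) (f g : A → ℕ) → ∑ xs (λ x → f x + g x) ≡ ∑ xs f + ∑ xs g
∑-+ []       f g = ≡-refl
∑-+ (x ∷ xs) f g = ≡-trans (cong ((f x + g x) +_) (∑-+ xs f g))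
  (interchange +-commutativeSemigroup (f x) (g x) (∑ xs f) (∑ xs g))

∑-swap : (xs : List A) (ys : List B) (f : A → B → ℕ) →
         ∑ xs (λ x → ∑ ys (f x)) ≡ ∑ ys (λ y → ∑ xs (λ x → f x y))
∑-swap []       ys f = ≡-sym (∑-zero ys)
  where
  ∑-zero : (ys : List B) → ∑ ys (λ _ → 0) ≡ 0
  ∑-zero []       = ≡-refl
  ∑-zero (_ ∷ ys) = ∑-zero ys
∑-swap (x ∷ xs) ys f = ≡-trans (cong (∑ ys (f x) +_) (∑-swap xs ys f))
  (≡-sym (∑-+ ys (f x) (λ y → ∑ xs (λ x → f x y))))

∑-*ʳ : (xs : List A) (f : A → ℕ) (k : ℕ) → ∑ xs f * k ≡ ∑ xs (λ x → f x * k)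
∑-*ʳ []       f k = ≡-refl
∑-*ʳ (x ∷ xs) f k = ≡-trans (*-distribʳ-+ k (f x) _) (cong (f x * k +_) (∑-*ʳ xs f k))

cnt : (A → Bool) → List A → ℕ
cnt p xs = ∑ xs (ind ∘ p)

cnt-mono : {p q : A → Bool} (xs : List A) →
           (∀ {x} → x ∈ xs → p x ≡ true → q x ≡ true) → cnt p xs ≤ cnt q xs
cnt-mono xs p⊆q = ∑-mono xs (ind-mono ∘ p⊆q)

cnt-++ : (p : A → Bool) (xs ys : List A) → cnt p (xs ++ ys) ≡ cnt p xs + cnt p ys
cnt-++ p xs ys = ≡-trans (cong sum (map-++ (ind ∘ p) xs ys)) (sum-++ (map (ind ∘ p) xs) _)

cnt-↭ : (p : A → Bool) {xs ys : List A} → xs ↭ ys → cnt p xs ≡ cnt p ys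
cnt-↭ p σ = sum-↭ (Perm.map⁺ (ind ∘ p) σ)

cnt-true : (xs : List A) → cnt (λ _ → true) xs ≡ length xs
cnt-true []       = ≡-refl
cnt-true (_ ∷ xs) = cong suc (cnt-true xs)

cnt-∨ : (p q : A → Bool) (xs : List A) → cnt (λ x → p x ∨ q x) xs ≤ cnt p xs + cnt q xs
cnt-∨ p q xs = ≤-trans (∑-mono xs λ {x} _ → ind-∨ (p x) (q x)) (≤-reflexive (∑-+ xs _ _))
  where
  ind-∨ : ∀ a b → ind (a ∨ b) ≤ ind a + ind b
  ind-∨ true  _ = s≤s z≤n
  ind-∨ false _ = ≤-refl

cnt-complement : (p : A → Bool) (xs : List A) → cnt p xs + cnt (not ∘ p) xs ≡ length xs
cnt-complement p xs = ≡-trans (≡-sym (∑-+ xs _ _)) (≡-trans (go xs) (cnt-true xs))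
  where
  ind-not : ∀ b → ind b + ind (not b) ≡ 1
  ind-not true  = ≡-refl
  ind-not false = ≡-refl
  go : ∀ xs → ∑ xs (λ x → ind (p x) + ind (not (p x))) ≡ cnt (λ _ → true) xs
  go []       = ≡-refl
  go (x ∷ xs) = cong₂ _+_ (ind-not (p x)) (go xs)

cnt-positive : (p : A → Bool) {xs : List A} {x : A} → x ∈ xs → p x ≡ true → 0 < cnt p xs
cnt-positive p (here ≡-refl) px rewrite px = s≤s z≤n
cnt-positive p {x ∷ _} (there i) px = ≤-trans (cnt-positive p i px) (m≤n+m _ (ind (p x)))

cnt-witness : (p : A → Bool) (xs : List A) → 0 < cnt p xs → ∃ λ x → x ∈ xs × p x ≡ true
cnt-witness p (x ∷ xs) 0<c with p x in eq
... | true  = x , here ≡-refl , eq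
... | false with cnt-witness p xs 0<c
...   | y , i , py = y , there i , py

cnt-filter : {P : A → Set} (P? : Decidable P) (p : A → Bool) (xs : List A) →
             cnt p (filter P? xs) ≡ cnt (λ x → ⌊ P? x ⌋ ∧ p x) xs
cnt-filter P? p []       = ≡-refl
cnt-filter P? p (x ∷ xs) with P? x
... | yes _ = cong (ind (p x) +_) (cnt-filter P? p xs)
... | no  _ = cnt-filter P? p xs

-- Each element counted on the left is brought to the front of `ys` by a permutation and removed
-- there; as `xs` has no repetitions, the elements still to be counted survive in the remainder.
cnt-⊆ : {p q : A → Bool} {xs : List A} (ys : List A) → Unique xs →
        (∀ {x} → x ∈ xs → p x ≡ true → x ∈ ys × q x ≡ true) → cnt p xs ≤ cnt q ys
cnt-⊆ {xs = []} ys _ _ = z≤n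
cnt-⊆ {p = p} {q} {x ∷ xs} ys (x∉ ∷ u) f with p x in eq
... | false = cnt-⊆ ys u (f ∘ there)
... | true with f (here ≡-refl) eq
...   | x∈ys , qx with ∈-∃++ x∈ys
...     | as , bs , ≡-refl = begin
  suc (cnt p xs)           ≤⟨ s≤s (cnt-⊆ (as ++ bs) u f′) ⟩
  suc (cnt q (as ++ bs))   ≡⟨ cong (λ b → ind b + cnt q (as ++ bs)) qx ⟨
  cnt q (x ∷ as ++ bs)     ≡⟨ cnt-↭ q (Perm.shift x as bs) ⟨
  cnt q (as ++ x ∷ bs)     ∎
  where
  open ≤-Reasoning
  drop : ∀ {y} → y ≢ x → y ∈ as ++ x ∷ bs → y ∈ as ++ bs
  drop y≢x i with Perm.∈-resp-↭ (Perm.shift x as bs) i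
  ... | here y≡x = contradiction y≡x y≢x
  ... | there j  = j
  f′ : ∀ {y} → y ∈ xs → p y ≡ true → y ∈ as ++ bs × q y ≡ true
  f′ i py = drop (λ { ≡-refl → All.lookup x∉ i ≡-refl }) (proj₁ (f (there i) py)) , proj₂ (f (there i) py)

-- Augmenting paths in bipartite matchings.

module Matching {n} {E : Fin n → Fin n → Set} (E? : Decidable₂ E) where

  private
    V : Set
    V = Fin n

  Pairs : Set
  Pairs = List (V × V)

  lefts rights : Pairs → List V
  lefts  = map proj₁
  rights = map proj₂

  Edges : Pairs → Set
  Edges = All λ (u , w) → E u w

  -- Removing each matching edge as it is traversed keeps alternating paths simple.
  data Alternating : Pairs → V → V → Set where
    direct : ∀ {M x y} → E x y → Alternating M x y
    detour : ∀ {M M′ x y u w} → E x w → M ↭ (u , w) ∷ M′ → Alternating M′ u y → Alternating M x y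

  alternating-↭ : ∀ {M M′ x y} → M ↭ M′ → Alternating M x y → Alternating M′ x y
  alternating-↭ σ (direct e)     = direct e
  alternating-↭ σ (detour e τ a) = detour e (↭-trans (↭-sym σ) τ) a

  alternating-∷ : ∀ {M x y} p → Alternating M x y → Alternating (p ∷ M) x y
  alternating-∷ p (direct e)     = direct e
  alternating-∷ p (detour e σ a) =
    detour e (↭-trans (prep p σ) (swap p _ refl)) (alternating-∷ p a)

  alternating-++ : ∀ {M x y} ps → Alternating M x y → Alternating (ps ++ M) x y
  alternating-++ []       a = a
  alternating-++ (p ∷ ps) a = alternating-∷ p (alternating-++ ps a)

  -- A detour trades the pair `(u , w)` for `(x , w)` and leaves `u` to be rematched along the rest
  -- of the path. As multisets, the left ends thus gain exactly `x` and the right ends exactly `y`.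
  augment : ∀ {M x y} → Alternating M x y → Edges M →
            ∃ λ M′ → lefts M′ ↭ x ∷ lefts M × rights M′ ↭ y ∷ rights M × Edges M′
  augment (direct e) es = _ , refl , refl , e ∷ es
  augment (detour {x = x} {y} {u} {w} e σ a) es with Perm.All-resp-↭ σ es
  ... | _ ∷ es′ with augment a es′
  ...   | M′ , ls , rs , es″ =
    (x , w) ∷ M′
    , prep x (↭-trans ls (↭-sym (Perm.map⁺ proj₁ σ)))
    , ↭-trans (prep w rs) (↭-trans (swap w y refl) (prep y (↭-sym (Perm.map⁺ proj₂ σ))))
    , e ∷ es″

  -- The complements of `fromLeft` and `fromRight` form a Hall-type obstruction: by `forward`, edges
  -- out of the left complement stay in the right complement, and by `backward`, a pair whose right
  -- end is in the complement has its left end there too.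
  record Reachability (M : Pairs) (Y : V → Bool) : Set where
    field
      fromLeft fromRight : V → Bool
      path     : ∀ {x} → fromLeft x ≡ true → ∃ λ y → Y y ≡ true × Alternating M x y
      targets  : ∀ {w} → Y w ≡ true → fromRight w ≡ true
      forward  : ∀ {u w} → E u w → fromRight w ≡ true → fromLeft u ≡ true
      backward : ∀ {u w} → (u , w) ∈ M → fromLeft u ≡ true → fromRight w ≡ true

  private
    find : (G : V → Bool) (M : Pairs) →
           (∃₂ λ p M′ → M ↭ p ∷ M′ × G (proj₁ p) ≡ true) ⊎ (∀ {u w} → (u , w) ∈ M → G u ≡ false)
    find G [] = inj₂ λ ()
    find G (p ∷ M) with G (proj₁ p) in eq
    ... | true = inj₁ (p , M , refl , eq)
    ... | false with find G M
    ...   | inj₁ (q , M′ , σ , Gq) = inj₁ (q , p ∷ M′ , ↭-trans (prep p σ) (swap p q refl) , Gq)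
    ...   | inj₂ none = inj₂ λ { (here ≡-refl) → eq ; (there i) → none i }

    -- Search backwards from `Y`. `U` holds the pairs already crossed and `Rest` the others; the
    -- known paths use pairs of `U` only, so a pair moved over from `Rest` can be put in front of
    -- any of them.
    grow : ∀ {M Y} k U Rest → length Rest ≡ k → Rest ++ U ↭ M → (L R : V → Bool) →
           (∀ {x} → L x ≡ true → ∃ λ y → Y y ≡ true × Alternating U x y) →
           (∀ {w} → Y w ≡ true → R w ≡ true) →
           (∀ {u w} → E u w → R w ≡ true → L u ≡ true) →
           (∀ {u w} → (u , w) ∈ U → R w ≡ true) →
           Reachability M Y
    grow k U Rest len σ L R path targets forward used with find L Rest
    grow k U Rest len σ L R path targets forward used | inj₂ none = record
      { fromLeft  = L
      ; fromRight = R
      ; path      = λ Lx → let y , Yy , a = path Lx in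
                      y , Yy , alternating-↭ σ (alternating-++ Rest a)
      ; targets   = targets
      ; forward   = forward
      ; backward  = λ i Lu → back (∈-++⁻ Rest (Perm.∈-resp-↭ (↭-sym σ) i)) Lu
      }
      where
      back : ∀ {u w} → (u , w) ∈ Rest ⊎ (u , w) ∈ U → L u ≡ true → R w ≡ true
      back (inj₁ i) Lu = ⊥-elim (false≢true (none i) Lu)
      back (inj₂ i) _  = used i
    grow zero U Rest len σ L R path targets forward used | inj₁ (p , M′ , τ , _) =
      contradiction (≡-trans (≡-sym len) (Perm.↭-length τ)) λ ()
    grow {Y = Y} (suc k) U Rest len σ L R path targets forward used | inj₁ ((u₀ , w₀) , M′ , τ , Lu₀) =
      grow k ((u₀ , w₀) ∷ U) M′ (suc-injective (≡-trans (≡-sym (Perm.↭-length τ)) len))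
        (↭-trans (Perm.shift (u₀ , w₀) M′ U) (↭-trans (Perm.++⁺ʳ U (↭-sym τ)) σ))
        L′ R′ path′ (λ Yw → ∨-introˡ (targets Yw)) forward′ used′
      where
      L′ R′ : V → Bool
      L′ u = L u ∨ ⌊ E? u w₀ ⌋
      R′ w = R w ∨ ⌊ w ≟ w₀ ⌋

      path′ : ∀ {x} → L′ x ≡ true → ∃ λ y → Y y ≡ true × Alternating ((u₀ , w₀) ∷ U) x y
      path′ {x} L′x with L x in eq
      ... | true  = let y , Yy , a = path eq in y , Yy , alternating-∷ _ a
      -- A newly reached `x` goes to `w₀`, back along the pair to `u₀`, and on along the path known
      -- for `u₀`.
      ... | false = let y , Yy , a = path Lu₀ in y , Yy , detour (sound (E? x w₀) L′x) refl a

      forward′ : ∀ {u w} → E u w → R′ w ≡ true → L′ u ≡ true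
      forward′ {u} {w} e R′w with R w in eq
      ... | true  = ∨-introˡ (forward e eq)
      ... | false with sound (w ≟ w₀) R′w
      ...   | ≡-refl = ∨-introʳ (L u) (complete (E? u w₀) e)

      used′ : ∀ {u w} → (u , w) ∈ (u₀ , w₀) ∷ U → R′ w ≡ true
      used′ (here ≡-refl) = ∨-introʳ (R w₀) (complete (w₀ ≟ w₀) ≡-refl)
      used′ (there i)     = ∨-introˡ (used i)

  reachability : ∀ M Y → Reachability M Y
  reachability M Y = grow (length M) [] M ≡-refl (↭-reflexive (++-identityʳ M))
    (λ u → ⌊ target? u ⌋) Y
    (λ {u} Lu → let w , Yw , e = sound (target? u) Lu in w , Yw , direct e)
    (λ Yw → Yw)
    (λ {u} {w} e Yw → complete (target? u) (w , Yw , e))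
    λ ()
    where
    target? : ∀ u → Dec (∃ λ w → Y w ≡ true × E u w)
    target? u = any? λ w → (Y w ≟ᵇ true) ×-dec E? u w

-- Classes, chains of classes and disjoint paths along a chain.

-- Colours are elements of Fin n as well: below, κ v is a chosen member of the class of v.
module Colours {n} (adj : Fin n → Fin n → Bool) (κ : Fin n → Fin n) (τ : ℕ) where

  private V = Fin n

  open DecMembership {A = V} _≟_ using (_∈?_)

  members : V → List V
  members c = filter (λ v → κ v ≟ c) (allFin n)

  size : V → ℕ
  size c = length (members c)

  members-unique : ∀ c → Unique (members c)
  members-unique c = Unique.filter⁺ (λ v → κ v ≟ c) (Unique.allFin⁺ n)

  ∈-members⁺ : ∀ {v c} → κ v ≡ c → v ∈ members c
  ∈-members⁺ {v} {c} κv≡c = ∈-filter⁺ (λ v → κ v ≟ c) (∈-allFin v) κv≡c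

  ∈-members⁻ : ∀ {v c} → v ∈ members c → κ v ≡ c
  ∈-members⁻ {c = c} i = proj₂ (∈-filter⁻ (λ v → κ v ≟ c) {xs = allFin n} i)

  -- The normalized matching property, cleared of denominators: the fraction of `d` filled by `Y` is
  -- at least the fraction of `c` filled by `X`, whenever `Y` contains the neighbours in `d` of `X`
  -- in `c`.
  NormalizedMatching : V → V → Set
  NormalizedMatching c d = ∀ (X Y : V → Bool) →
    (∀ {u w} → κ u ≡ c → κ w ≡ d → X u ≡ true → adj u w ≡ true → Y w ≡ true) →
    cnt X (members c) * size d ≤ cnt Y (members d) * size c

  _⇝_ : V → V → Set
  c ⇝ d = NormalizedMatching c d × τ < size d

  data Chain : V → List V → V → Set where
    one : ∀ {c d} → c ⇝ d → Chain c [] d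
    _∷_ : ∀ {c e is d} → c ⇝ e → Chain e is d → Chain c (e ∷ is) d

  Link : V → List V → V → V → V → Set
  Link c []       d a b = a ≡ c × b ≡ d
  Link c (e ∷ is) d a b = (a ≡ c × b ≡ e) ⊎ Link e is d a b

  link? : ∀ c is d a b → Dec (Link c is d a b)
  link? c []       d a b = (a ≟ c) ×-dec (b ≟ d)
  link? c (e ∷ is) d a b = ((a ≟ c) ×-dec (b ≟ e)) ⊎-dec link? e is d a b

  -- Every vertex has a left and a right copy; a loop in a matching marks a vertex that no path uses.
  Edge : V → List V → V → V → V → Set
  Edge c is d u w = u ≡ w ⊎ (Link c is d (κ u) (κ w) × adj u w ≡ true)

  edge? : ∀ c is d u w → Dec (Edge c is d u w)
  edge? c is d u w = (u ≟ w) ⊎-dec (link? c is d (κ u) (κ w) ×-dec (adj u w ≟ᵇ true))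

  interior : List V → List V
  interior = concatMap members

  -- Encodes disjoint paths from `S` to `S′` through the interior classes as a perfect matching
  -- between copies: every start and every interior vertex has one successor, every end and every
  -- interior vertex one predecessor.
  record Linked (c : V) (is : List V) (d : V) (S S′ : List V) : Set where
    open Matching (edge? c is d)
    field
      pairs       : Pairs
      lefts-pairs  : lefts pairs ↭ S ++ interior is
      rights-pairs : rights pairs ↭ S′ ++ interior is
      edges       : Edges pairs

  linked-length : ∀ {c is d S S′} → Linked c is d S S′ → length S ≡ length S′
  linked-length {is = is} {S = S} {S′} l = +-cancelʳ-≡ (length (interior is)) _ _ (begin
    length S + length (interior is)  ≡⟨ length-++ S ⟨
    length (S ++ interior is)        ≡⟨ Perm.↭-length lefts-pairs ⟨
    length (map proj₁ pairs)         ≡⟨ length-map proj₁ pairs ⟩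
    length pairs                     ≡⟨ length-map proj₂ pairs ⟨
    length (map proj₂ pairs)         ≡⟨ Perm.↭-length rights-pairs ⟩
    length (S′ ++ interior is)       ≡⟨ length-++ S′ ⟩
    length S′ + length (interior is) ∎)
    where
    open ≡-Reasoning
    open Linked l

  module _ (Z N : V → Bool) (Z⊆N : ∀ {u} → Z u ≡ true → N u ≡ true) where

    excess : List V → ℕ
    excess []       = 0
    excess (e ∷ is) = (cnt N (members e) ∸ cnt Z (members e)) + excess is

    excess-interior : ∀ is → excess is + cnt Z (interior is) ≡ cnt N (interior is)
    excess-interior []       = ≡-refl
    excess-interior (e ∷ is) = begin
      (N′ ∸ Z′ + excess is) + cnt Z (members e ++ interior is)
        ≡⟨ cong ((N′ ∸ Z′ + excess is) +_) (cnt-++ Z (members e) (interior is)) ⟩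
      (N′ ∸ Z′ + excess is) + (Z′ + cnt Z (interior is))
        ≡⟨ interchange +-commutativeSemigroup (N′ ∸ Z′) _ Z′ _ ⟩
      (N′ ∸ Z′ + Z′) + (excess is + cnt Z (interior is))
        ≡⟨ cong₂ _+_ (m∸n+n≡m (cnt-mono (members e) λ _ → Z⊆N)) (excess-interior is) ⟩
      N′ + cnt N (interior is)
        ≡⟨ cnt-++ N (members e) (interior is) ⟨
      cnt N (members e ++ interior is) ∎
      where
      open ≡-Reasoning
      N′ Z′ : ℕ
      N′ = cnt N (members e)
      Z′ = cnt Z (members e)

    -- Inequalities `cnt * suc τ ≤ α * size` say that a set fills at most α / (τ + 1) of its class.
    -- Normalized matching compares the fraction of `Z` in `c` with that of `N` in `d`; the factor
    -- `size d`, positive because `d` is large, cancels.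
    pull-back : ∀ {c d} α → c ⇝ d →
                (∀ {u w} → κ u ≡ c → κ w ≡ d → Z u ≡ true → adj u w ≡ true → N w ≡ true) →
                cnt N (members d) * suc τ ≤ α * size d → cnt Z (members c) * suc τ ≤ α * size c
    pull-back {c} {d} α (nm , big) ZN bound = *-cancelʳ-≤ _ _ (size d) {{>-nonZero (≤-trans (s≤s z≤n) big)}} (begin
      (z * suc τ) * size d ≡⟨ *-assoc z _ _ ⟩
      z * (suc τ * size d) ≡⟨ cong (z *_) (*-comm (suc τ) _) ⟩
      z * (size d * suc τ) ≡⟨ *-assoc z _ _ ⟨
      (z * size d) * suc τ ≤⟨ *-monoˡ-≤ (suc τ) (nm Z N ZN) ⟩
      (v * size c) * suc τ ≡⟨ *-assoc v _ _ ⟩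
      v * (size c * suc τ) ≡⟨ cong (v *_) (*-comm (size c) _) ⟩
      v * (suc τ * size c) ≡⟨ *-assoc v _ _ ⟨
      (v * suc τ) * size c ≤⟨ *-monoˡ-≤ (size c) bound ⟩
      (α * size d) * size c ≡⟨ *-assoc α _ _ ⟩
      α * (size d * size c) ≡⟨ cong (α *_) (*-comm (size d) _) ⟩
      α * (size c * size d) ≡⟨ *-assoc α _ _ ⟨
      (α * size c) * size d ∎)
      where
      open ≤-Reasoning
      z v : ℕ
      z = cnt Z (members c)
      v = cnt N (members d)

    -- The bound travels back along the chain. `pull-back` passes from `N` in one class to `Z` in
    -- the class before; within an interior class `e`, the vertices of `N` outside `Z` add at most 1
    -- / (τ + 1) each, because `e` has more than `τ` elements. They are what `excess` counts.
    density : ∀ {c is d} α → Chain c is d →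
              (∀ {u w} → Link c is d (κ u) (κ w) → Z u ≡ true → adj u w ≡ true → N w ≡ true) →
              cnt N (members d) * suc τ ≤ α * size d →
              cnt Z (members c) * suc τ ≤ (α + excess is) * size c
    density α (one q) ZN bound rewrite +-identityʳ α =
      pull-back α q (λ κu κw → ZN (κu , κw)) bound
    density {c} {e ∷ is} {d} α (q ∷ ch) ZN bound =
      pull-back (α + (N′ ∸ Z′ + excess is)) q (λ κu κw → ZN (inj₁ (κu , κw))) (begin
        N′ * suc τ
          ≡⟨ cong (_* suc τ) (m∸n+n≡m (cnt-mono (members e) λ _ → Z⊆N)) ⟨
        (N′ ∸ Z′ + Z′) * suc τ
          ≡⟨ *-distribʳ-+ (suc τ) (N′ ∸ Z′) Z′ ⟩
        (N′ ∸ Z′) * suc τ + Z′ * suc τ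
          ≤⟨ +-mono-≤ (*-monoʳ-≤ (N′ ∸ Z′) (proj₂ q)) (density α ch (ZN ∘ inj₂) bound) ⟩
        (N′ ∸ Z′) * size e + (α + excess is) * size e
          ≡⟨ *-distribʳ-+ (size e) (N′ ∸ Z′) _ ⟨
        ((N′ ∸ Z′) + (α + excess is)) * size e
          ≡⟨ cong (_* size e) (x∙yz≈y∙xz (N′ ∸ Z′) α (excess is)) ⟩
        (α + ((N′ ∸ Z′) + excess is)) * size e ∎)
      where
      open ≤-Reasoning
      open CommutativeSemigroup +-commutativeSemigroup using (x∙yz≈y∙xz)
      N′ Z′ : ℕ
      N′ = cnt N (members e)
      Z′ = cnt Z (members e)

  not-antitone : ∀ {a b} → (b ≡ true → a ≡ true) → not a ≡ true → not b ≡ true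
  not-antitone {false} {false} _ _ = ≡-refl
  not-antitone {false} {true} f _ = f ≡-refl

  -- `Bad` collects the starts in use and the vertices without an alternating path to a good vertex
  -- of `d`. Comparing both sides of the matching bounds the total excess by the number of starts in
  -- `Z`; the starts outside `Z` are charged directly, so the numerator grows by `length S` in all.
  extend-linked : ∀ {c is d α S S′} → Chain c is d → τ < size c → Linked c is d S S′ →
    (Bad′ : V → Bool) → cnt Bad′ (members d) * suc τ ≤ α * size d →
    ∃ λ (Bad : V → Bool) → (∀ {s} → s ∈ S → Bad s ≡ true) ×
      cnt Bad (members c) * suc τ ≤ (length S + α) * size c ×
      (∀ {b} → Bad b ≡ false → ∃ λ b′ → κ b′ ≡ d × Bad′ b′ ≡ false × Linked c is d (b ∷ S) (b′ ∷ S′))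
  extend-linked {c} {is} {d} {α} {S} {S′} ch big linked Bad′ bound =
    Bad , (λ {s} s∈S → ∨-introʳ (Z s) (complete (s ∈? S) s∈S)) , bound′ , extend
    where
    open Linked linked
    open Matching (edge? c is d)
    Y : V → Bool
    Y w = ⌊ κ w ≟ d ⌋ ∧ not (Bad′ w)
    open Reachability (reachability pairs Y)
    Z N Bad : V → Bool
    Z = not ∘ fromLeft
    N = not ∘ fromRight
    Bad v = Z v ∨ ⌊ v ∈? S ⌋

    Z⊆N : ∀ {u} → Z u ≡ true → N u ≡ true
    Z⊆N = not-antitone (forward (inj₁ ≡-refl))

    N⊆Bad′ : ∀ {w} → w ∈ members d → N w ≡ true → Bad′ w ≡ true
    N⊆Bad′ {w} w∈d Nw with Bad′ w in eq
    ... | true  = ≡-refl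
    ... | false = contradiction (targets Yw) λ Rw → false≢true (not-true Nw) Rw
      where
      Yw : Y w ≡ true
      Yw rewrite eq | complete (κ w ≟ d) (∈-members⁻ w∈d) = ≡-refl

    -- By the contrapositive of `backward`, each pair with right end in `N` has its left end in `Z`.
    matched : cnt N (S′ ++ interior is) ≤ cnt Z (S ++ interior is)
    matched = begin
      cnt N (S′ ++ interior is)     ≡⟨ cnt-↭ N rights-pairs ⟨
      cnt N (map proj₂ pairs)       ≡⟨ cong sum (map-∘ pairs) ⟨
      cnt (N ∘ proj₂) pairs         ≤⟨ cnt-mono pairs (λ i → not-antitone (backward i)) ⟩
      cnt (Z ∘ proj₁) pairs         ≡⟨ cong sum (map-∘ pairs) ⟩
      cnt Z (map proj₁ pairs)       ≡⟨ cnt-↭ Z lefts-pairs ⟩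
      cnt Z (S ++ interior is)      ∎
      where open ≤-Reasoning

    excess≤ : excess Z N Z⊆N is ≤ cnt Z S
    excess≤ = +-cancelʳ-≤ (cnt Z (interior is)) _ _ (begin
      excess Z N Z⊆N is + cnt Z (interior is) ≡⟨ excess-interior Z N Z⊆N is ⟩
      cnt N (interior is)                     ≤⟨ m≤n+m _ (cnt N S′) ⟩
      cnt N S′ + cnt N (interior is)          ≡⟨ cnt-++ N S′ _ ⟨
      cnt N (S′ ++ interior is)               ≤⟨ matched ⟩
      cnt Z (S ++ interior is)                ≡⟨ cnt-++ Z S _ ⟩
      cnt Z S + cnt Z (interior is)           ∎)
      where open ≤-Reasoning

    -- Starts inside `Z` are not charged again here: they already pay for `excess`.
    Bad-split : cnt Bad (members c) ≤ cnt Z (members c) + cnt (not ∘ Z) S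
    Bad-split = begin
      cnt Bad (members c)
        ≤⟨ cnt-mono (members c) (λ {v} _ → split (Z v)) ⟩
      cnt (λ v → Z v ∨ (not (Z v) ∧ ⌊ v ∈? S ⌋)) (members c)
        ≤⟨ cnt-∨ Z _ (members c) ⟩
      cnt Z (members c) + cnt (λ v → not (Z v) ∧ ⌊ v ∈? S ⌋) (members c)
        ≤⟨ +-monoʳ-≤ (cnt Z (members c)) (cnt-⊆ S (members-unique c) λ {v} _ p →
             sound (v ∈? S) (proj₂ (∧-true p)) , proj₁ (∧-true p)) ⟩
      cnt Z (members c) + cnt (not ∘ Z) S ∎
      where
      open ≤-Reasoning
      split : ∀ a {b} → a ∨ b ≡ true → a ∨ (not a ∧ b) ≡ true
      split true  _ = ≡-refl
      split false p = p

    bound′ : cnt Bad (members c) * suc τ ≤ (length S + α) * size c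
    bound′ = begin
      cnt Bad (members c) * suc τ
        ≤⟨ *-monoˡ-≤ (suc τ) Bad-split ⟩
      (cnt Z (members c) + cnt (not ∘ Z) S) * suc τ
        ≡⟨ *-distribʳ-+ (suc τ) (cnt Z (members c)) _ ⟩
      cnt Z (members c) * suc τ + cnt (not ∘ Z) S * suc τ
        ≤⟨ +-mono-≤ (density Z N Z⊆N α ch
                       (λ l Zu e → not-antitone (forward (inj₂ (l , e))) Zu)
                       (≤-trans (*-monoˡ-≤ (suc τ) (cnt-mono (members d) N⊆Bad′)) bound))
                    (*-monoʳ-≤ (cnt (not ∘ Z) S) big) ⟩
      (α + excess Z N Z⊆N is) * size c + cnt (not ∘ Z) S * size c
        ≤⟨ +-monoˡ-≤ _ (*-monoˡ-≤ (size c) (+-monoʳ-≤ α excess≤)) ⟩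
      (α + cnt Z S) * size c + cnt (not ∘ Z) S * size c
        ≡⟨ *-distribʳ-+ (size c) (α + cnt Z S) _ ⟨
      (α + cnt Z S + cnt (not ∘ Z) S) * size c
        ≡⟨ cong (_* size c) (+-assoc α _ _) ⟩
      (α + (cnt Z S + cnt (not ∘ Z) S)) * size c
        ≡⟨ cong (λ k → (α + k) * size c) (cnt-complement Z S) ⟩
      (α + length S) * size c
        ≡⟨ cong (_* size c) (+-comm α _) ⟩
      (length S + α) * size c ∎
      where open ≤-Reasoning

    extend : ∀ {b} → Bad b ≡ false →
             ∃ λ b′ → κ b′ ≡ d × Bad′ b′ ≡ false × Linked c is d (b ∷ S) (b′ ∷ S′)
    extend {b} ¬Bad with fromLeft b in eq
    extend {b} () | false
    ... | true with path eq
    ...   | b′ , Yb′ , a with augment a edges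
    ...     | M , ls , rs , es =
      b′ , sound (κ b′ ≟ d) (proj₁ (∧-true Yb′)) , not-true (proj₂ (∧-true Yb′)) , record
        { pairs        = M
        ; lefts-pairs  = ↭-trans ls (prep b lefts-pairs)
        ; rights-pairs = ↭-trans rs (prep b′ rights-pairs)
        ; edges        = es
        }

  -- Trees of classes and packings of disjoint subtrees.

  -- A `seg` bundles a whole chain, so that vertices of degree two are not charged one by one;
  -- `fork` glues two trees at their common root class, and `stop` marks a terminal class.
  data Tree : V → Set where
    stop : ∀ {c} → Tree c
    seg  : ∀ {c is d} → Chain c is d → Tree d → Tree c
    fork : ∀ {c} → Tree c → Tree c → Tree c

  body : ∀ {c} → Tree c → List V
  body stop                   = []
  body (seg {is = is} {d} _ t) = is ++ d ∷ body t
  body (fork t₁ t₂)           = body t₁ ++ body t₂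

  -- With k subtrees packed, each segment and each leaf contributes k / (τ + 1) to the bound on the
  -- fraction of unusable roots; a fork only adds the bounds of its branches.
  cost : ∀ {c} → Tree c → ℕ
  cost stop         = 1
  cost (seg _ t)    = suc (cost t)
  cost (fork t₁ t₂) = cost t₁ + cost t₂

  data Leaf (a : V) : ∀ {c} → Tree c → Set where
    stop  : Leaf a {a} stop
    seg   : ∀ {c is d} {ch : Chain c is d} {t} → Leaf a t → Leaf a (seg ch t)
    forkˡ : ∀ {c} {t₁ t₂ : Tree c} → Leaf a t₁ → Leaf a (fork t₁ t₂)
    forkʳ : ∀ {c} {t₁ t₂ : Tree c} → Leaf a t₂ → Leaf a (fork t₁ t₂)

  -- `S` lists the roots of the subtrees. Disjointness between different parts of the tree comes
  -- later, from the distinctness of the classes in `c ∷ body t`.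
  Packed : ∀ {c} → Tree c → List V → Set
  Packed stop _ = ⊤
  Packed (seg {c} {is} {d} _ t) S =
    Σ[ S′ ∈ List V ] All (λ v → κ v ≡ d) S′ × Unique S′ × Linked c is d S S′ × Packed t S′
  Packed (fork t₁ t₂) S = Packed t₁ S × Packed t₂ S

  chain-big : ∀ {c is d} → Chain c is d → τ < size d
  chain-big (one q)  = proj₂ q
  chain-big (_ ∷ ch) = chain-big ch

  unique-∷ : ∀ {x : V} {xs} → x ∉ xs → Unique xs → Unique (x ∷ xs)
  unique-∷ x∉ u = All.¬Any⇒All¬ _ x∉ ∷ u

  packed-empty : ∀ {c} (t : Tree c) → Packed t []
  packed-empty stop = tt
  packed-empty (seg {c} {is} {d} ch t) = [] , [] , [] , record
    { pairs        = map (λ v → v , v) (interior is)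
    ; lefts-pairs  = ↭-reflexive (≡-trans (≡-sym (map-∘ (interior is))) (map-id _))
    ; rights-pairs = ↭-reflexive (≡-trans (≡-sym (map-∘ (interior is))) (map-id _))
    ; edges        = All.map⁺ (All.universal (λ _ → inj₁ ≡-refl) _)
    } , packed-empty t
  packed-empty (fork t₁ t₂) = packed-empty t₁ , packed-empty t₂

  -- Recursion from the leaves to the root. A leaf forbids only the roots in use, a segment adds
  -- `length S` by `extend-linked`, and at a fork the forbidden sets are united.
  extend : ∀ {c} (t : Tree c) → τ < size c → ∀ S → Packed t S →
    ∃ λ (Bad : V → Bool) → (∀ {s} → s ∈ S → Bad s ≡ true) ×
      cnt Bad (members c) * suc τ ≤ (cost t * length S) * size c ×
      (∀ {b} → Bad b ≡ false → Packed t (b ∷ S))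
  extend {c} stop big S _ =
    (λ v → ⌊ v ∈? S ⌋) , (λ {s} → complete (s ∈? S)) , bound , λ _ → tt
    where
    bound : cnt (λ v → ⌊ v ∈? S ⌋) (members c) * suc τ ≤ (1 * length S) * size c
    bound rewrite *-identityˡ (length S) = *-mono-≤
      (≤-trans (cnt-⊆ {q = λ _ → true} S (members-unique c) λ {v} _ p → sound (v ∈? S) p , ≡-refl)
               (≤-reflexive (cnt-true S)))
      big
  extend {c} (seg {is = is} {d} ch t) big S (S′ , κS′ , uS′ , linked , packed)
    with extend t (chain-big ch) S′ packed
  ... | Bad′ , S′⊆Bad′ , bound′ , ext with extend-linked {α = cost t * length S} ch big linked Bad′
        (subst (λ k → cnt Bad′ (members d) * suc τ ≤ (cost t * k) * size d) (≡-sym (linked-length linked)) bound′)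
  ...   | Bad , S⊆Bad , bound , ext-linked = Bad , S⊆Bad , bound , λ ¬Bad →
    let b′ , κb′ , ¬Bad′ , linked′ = ext-linked ¬Bad in
    b′ ∷ S′ , κb′ ∷ κS′ , unique-∷ (λ i → false≢true ¬Bad′ (S′⊆Bad′ i)) uS′ , linked′ , ext ¬Bad′
  extend {c} (fork t₁ t₂) big S (packed₁ , packed₂)
    with extend t₁ big S packed₁ | extend t₂ big S packed₂
  ... | Bad₁ , S⊆₁ , bound₁ , ext₁ | Bad₂ , S⊆₂ , bound₂ , ext₂ =
    Bad , (λ i → ∨-introˡ (S⊆₁ i)) , bound , λ ¬Bad → ext₁ (∨-falseˡ ¬Bad) , ext₂ (∨-falseʳ ¬Bad)
    where
    Bad : V → Bool
    Bad v = Bad₁ v ∨ Bad₂ v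
    ∨-falseˡ : ∀ {a b} → a ∨ b ≡ false → a ≡ false
    ∨-falseˡ {false} _ = ≡-refl
    ∨-falseʳ : ∀ {a b} → a ∨ b ≡ false → b ≡ false
    ∨-falseʳ {false} p = p
    bound : cnt Bad (members c) * suc τ ≤ ((cost t₁ + cost t₂) * length S) * size c
    bound = begin
      cnt Bad (members c) * suc τ
        ≤⟨ *-monoˡ-≤ (suc τ) (cnt-∨ Bad₁ Bad₂ (members c)) ⟩
      (cnt Bad₁ (members c) + cnt Bad₂ (members c)) * suc τ
        ≡⟨ *-distribʳ-+ (suc τ) (cnt Bad₁ (members c)) _ ⟩
      cnt Bad₁ (members c) * suc τ + cnt Bad₂ (members c) * suc τ
        ≤⟨ +-mono-≤ bound₁ bound₂ ⟩
      (cost t₁ * length S) * size c + (cost t₂ * length S) * size c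
        ≡⟨ *-distribʳ-+ (size c) (cost t₁ * length S) _ ⟨
      (cost t₁ * length S + cost t₂ * length S) * size c
        ≡⟨ cong (_* size c) (*-distribʳ-+ (length S) (cost t₁) (cost t₂)) ⟨
      ((cost t₁ + cost t₂) * length S) * size c ∎
      where open ≤-Reasoning

  -- While fewer than `K` subtrees are packed, the forbidden fraction of the root class is at most τ
  -- / (τ + 1), so a vertex remains at which one more subtree can be rooted.
  packing : ∀ {c} (t : Tree c) → τ < size c → ∀ K → cost t * K ≤ τ →
            ∃ λ S → length S ≡ K × All (λ v → κ v ≡ c) S × Unique S × Packed t S
  packing t big zero    _     = [] , ≡-refl , [] , [] , packed-empty t
  packing {c} t big (suc K) bound
    with packing t big K (≤-trans (*-monoʳ-≤ (cost t) (n≤1+n K)) bound)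
  ... | S , ≡-refl , κS , uS , packed with extend t big S packed
  ...   | Bad , S⊆Bad , Bad-bound , ext with cnt-witness (not ∘ Bad) (members c) fresh
    where
    open ≤-Reasoning
    k≤τ : cost t * length S ≤ τ
    k≤τ = ≤-trans (*-monoʳ-≤ (cost t) (n≤1+n (length S))) bound
    few : cnt Bad (members c) < size c
    few = *-cancelʳ-< (suc τ) _ _ (begin-strict
      cnt Bad (members c) * suc τ   ≤⟨ Bad-bound ⟩
      cost t * length S * size c    ≤⟨ *-monoˡ-≤ (size c) k≤τ ⟩
      τ * size c                    <⟨ *-monoˡ-< (size c) {{>-nonZero (≤-trans (s≤s z≤n) big)}} (n<1+n τ) ⟩
      suc τ * size c                ≡⟨ *-comm (suc τ) (size c) ⟩
      size c * suc τ                ∎)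
    fresh : 0 < cnt (not ∘ Bad) (members c)
    fresh = +-cancelˡ-< (cnt Bad (members c)) _ _ (begin-strict
      cnt Bad (members c) + 0 ≡⟨ +-identityʳ _ ⟩
      cnt Bad (members c) <⟨ few ⟩
      size c ≡⟨ cnt-complement Bad (members c) ⟨
      cnt Bad (members c) + cnt (not ∘ Bad) (members c) ∎)
  ...     | b , b∈c , ¬Bad = b ∷ S , ≡-refl , ∈-members⁻ b∈c ∷ κS
    , unique-∷ (λ i → false≢true (not-true ¬Bad) (S⊆Bad i)) uS , ext (not-true ¬Bad)

-- Disjoint trees in the graph, read off from a packing.

unique-++⁻ : {A : Set} (xs : List A) {ys : List A} → Unique (xs ++ ys) →
             Unique xs × Unique ys × Disjoint xs ys
unique-++⁻ []       u        = [] , u , λ ()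
unique-++⁻ (x ∷ xs) {ys} (x∉ ∷ u) with unique-++⁻ xs u
... | uxs , uys , disjoint = All.++⁻ˡ xs x∉ ∷ uxs , uys , disjoint′
  where
  disjoint′ : Disjoint (x ∷ xs) ys
  disjoint′ (here ≡-refl , i) = All.lookup x∉ (∈-++⁺ʳ xs i) ≡-refl
  disjoint′ (there i , j)     = disjoint (i , j)

unique-map-injective : {A B : Set} {f : A → B} {xs : List A} → Unique (map f xs) →
                       ∀ {x y} → x ∈ xs → y ∈ xs → f x ≡ f y → x ≡ y
unique-map-injective _        (here ≡-refl) (here ≡-refl) _ = ≡-refl
unique-map-injective (u ∷ _)  (here ≡-refl) (there j) eq =
  ⊥-elim (All.lookup u (∈-map⁺ _ j) eq)
unique-map-injective (u ∷ _)  (there i) (here ≡-refl) eq =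
  ⊥-elim (All.lookup u (∈-map⁺ _ i) (≡-sym eq))
unique-map-injective (_ ∷ us) (there i) (there j) eq = unique-map-injective us i j eq

module Trees {n} (adj : Fin n → Fin n → Bool) (κ : Fin n → Fin n) (τ : ℕ) where

  open Colours adj κ τ
  private V = Fin n
  open DecMembership {A = V} _≟_ using (_∈?_)

  ∈-interior⁺ : ∀ {v is} → κ v ∈ is → v ∈ interior is
  ∈-interior⁺ {is = e ∷ is} (here κv)  = ∈-++⁺ˡ (∈-members⁺ κv)
  ∈-interior⁺ {is = e ∷ is} (there i) = ∈-++⁺ʳ (members e) (∈-interior⁺ i)

  ∈-interior⁻ : ∀ {v} is → v ∈ interior is → κ v ∈ is
  ∈-interior⁻ (e ∷ is) i with ∈-++⁻ (members e) i
  ... | inj₁ j = here (∈-members⁻ j)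
  ... | inj₂ j = there (∈-interior⁻ is j)

  interior-unique : ∀ {is} → Unique is → Unique (interior is)
  interior-unique []                = []
  interior-unique {e ∷ is} (e∉ ∷ u) = Unique.++⁺ (members-unique e) (interior-unique u)
    λ (i , j) → All.lookup e∉ (subst (_∈ is) (∈-members⁻ i) (∈-interior⁻ is j)) ≡-refl

  link-source : ∀ {c d a b} is → Link c is d a b → a ∈ c ∷ is
  link-source []       (a≡c , _)        = here a≡c
  link-source (e ∷ is) (inj₁ (a≡c , _)) = here a≡c
  link-source (e ∷ is) (inj₂ l)         = there (link-source is l)

  link-target : ∀ {c d a b} is {ds} → Link c is d a b → b ∈ is ++ d ∷ ds
  link-target []       (_ , b≡d)        = here b≡d
  link-target (e ∷ is) (inj₁ (_ , b≡e)) = here b≡e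
  link-target (e ∷ is) (inj₂ l)         = there (link-target is l)

  -- A forest whose arcs point away from the roots, so `Star (flip Arc)` climbs towards a root.
  -- `parent` makes the climb deterministic, and `target` confines the heads of arcs to classes of
  -- the body.
  record Branching {c} (t : Tree c) (S : List V) : Set₁ where
    field
      Arc      : V → V → Set
      adjacent : ∀ {u w} → Arc u w → adj u w ≡ true
      target   : ∀ {u w} → Arc u w → κ w ∈ body t
      parent   : ∀ {u u′ w} → Arc u w → Arc u′ w → u ≡ u′
      descend  : ∀ {s a} → s ∈ S → Leaf a t → ∃ λ v → κ v ≡ a × Star (flip Arc) v s

  Used : ∀ {c is d S S′} → Linked c is d S S′ → V → V → Set
  Used linked u w = (u , w) ∈ Linked.pairs linked × u ≢ w

  used-link : ∀ {c is d S S′} (linked : Linked c is d S S′) {u w} → Used linked u w →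
              Link c is d (κ u) (κ w) × adj u w ≡ true
  used-link linked (i , u≢w) with All.lookup (Linked.edges linked) i
  ... | inj₁ u≡w = contradiction u≡w u≢w
  ... | inj₂ l   = l

  module _ {c is d S S′} (linked : Linked c is d S S′) (uS′ : Unique S′)
           (κS′ : All (λ v → κ v ≡ d) S′) (uis : Unique (c ∷ is))
           (κS : All (λ v → κ v ≡ c) S) (d∉ : d ∉ c ∷ is) where
    open Linked linked

    private
      c∉is : c ∉ is
      c∉is = Unique.Unique[x∷xs]⇒x∉xs uis

      unique-tail : ∀ {x : V} {xs} → Unique (x ∷ xs) → Unique xs
      unique-tail (_ ∷ u) = u

      unique-rights : Unique (map proj₂ pairs)
      unique-rights = unique-↭ (↭-sym rights-pairs)
        (Unique.++⁺ uS′ (interior-unique (unique-tail uis)) λ (i , j) →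
          d∉ (there (subst (_∈ is) (All.lookup κS′ i) (∈-interior⁻ is j))))

    used-parent : ∀ {u u′ w} → Used linked u w → Used linked u′ w → u ≡ u′
    used-parent (i , _) (j , _) = cong proj₁ (unique-map-injective unique-rights i j ≡-refl)

    private
      leaving : ∀ {u} → u ∈ S ++ interior is → ∃ λ w → (u , w) ∈ pairs
      leaving i with ∈-map⁻ proj₁ (Perm.∈-resp-↭ (↭-sym lefts-pairs) i)
      ... | (_ , w) , j , ≡-refl = w , j

      -- Follows one path class by class, with `js` the interior classes still ahead. An interior
      -- vertex that has been entered is again the left end of a pair, and that pair leads into the
      -- next class.
      continue : ∀ {e} js → Unique (e ∷ js) → (∀ {a} → a ∈ js → a ∈ is) →
        (∀ {u w} → Used linked u w → κ u ∈ e ∷ js → Link e js d (κ u) (κ w)) →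
        ∀ {u w} → κ u ≡ e → Used linked u w → ∃ λ s′ → s′ ∈ S′ × Star (flip (Used linked)) s′ u
      continue [] _ _ link {u} {w} κu used = w , w∈S′ , used ◅ ε
        where
        w∈S′ : w ∈ S′
        w∈S′ with ∈-++⁻ S′ (Perm.∈-resp-↭ rights-pairs (∈-map⁺ proj₂ (proj₁ used)))
        ... | inj₁ i = i
        ... | inj₂ i = contradiction
          (there (subst (_∈ is) (proj₂ (link used (here κu))) (∈-interior⁻ is i))) d∉
      continue {e} (e′ ∷ js) (e∉ ∷ u-js) js⊆is link {u} {w} κu used with link used (here κu)
      ... | inj₂ l = contradiction ≡-refl
        (All.lookup e∉ (subst (_∈ e′ ∷ js) κu (link-source js l)))
      ... | inj₁ (_ , κw) with leaving (∈-++⁺ʳ S (∈-interior⁺ (subst (_∈ is) (≡-sym κw) (js⊆is (here ≡-refl)))))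
      ...   | w′ , i = let s′ , s′∈ , p = continue js u-js (js⊆is ∘ there) link′ κw (i , w≢w′) in
        s′ , s′∈ , p ◅◅ used ◅ ε
        where
        -- A loop at `w` would be a second pair with right end `w`, besides the one through which
        -- the path arrived.
        w≢w′ : w ≢ w′
        w≢w′ ≡-refl = proj₂ used (cong proj₁ (unique-map-injective unique-rights (proj₁ used) i ≡-refl))
        link′ : ∀ {u w} → Used linked u w → κ u ∈ e′ ∷ js → Link e′ js d (κ u) (κ w)
        link′ used′ κu∈ with link used′ (there κu∈)
        ... | inj₁ (κu≡e , _) = contradiction ≡-refl
          (All.lookup e∉ (subst (_∈ e′ ∷ js) κu≡e κu∈))
        ... | inj₂ l = l

    cross : ∀ {s} → s ∈ S → ∃ λ s′ → s′ ∈ S′ × Star (flip (Used linked)) s′ s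
    cross {s} s∈S with leaving (∈-++⁺ˡ s∈S)
    ... | w , i = continue is uis id (λ used _ → proj₁ (used-link linked used)) κs (i , s≢w)
      where
      κs : κ s ≡ c
      κs = All.lookup κS s∈S
      -- A start carries no loop because it is not a right end: its class `c` is neither `d` nor
      -- interior.
      s≢w : s ≢ w
      s≢w ≡-refl with ∈-++⁻ S′ (Perm.∈-resp-↭ rights-pairs (∈-map⁺ proj₂ i))
      ... | inj₁ j = d∉ (here (≡-trans (≡-sym (All.lookup κS′ j)) κs))
      ... | inj₂ j = c∉is (subst (_∈ is) κs (∈-interior⁻ is j))

  -- The arcs are the non-loop pairs of all segments. Distinct classes in `c ∷ body t` force arcs
  -- from different parts of the tree to enter different vertices, which keeps parents unique.
  branching : ∀ {c} (t : Tree c) {S} → Unique (c ∷ body t) → All (λ v → κ v ≡ c) S →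
              Packed t S → Branching t S
  branching stop _ κS _ = record
    { Arc      = λ _ _ → ⊥
    ; adjacent = λ ()
    ; target   = λ ()
    ; parent   = λ ()
    ; descend  = λ { s∈S stop → _ , All.lookup κS s∈S , ε }
    }
  branching {c} (seg {is = is} {d} ch t) {S} u κS (S′ , κS′ , uS′ , linked , packed) = record
    { Arc      = λ u w → Used linked u w ⊎ Arc u w
    ; adjacent = λ { (inj₁ used) → proj₂ (used-link linked used) ; (inj₂ arc) → adjacent arc }
    ; target   = λ { (inj₁ used) → link-target is (proj₁ (used-link linked used))
                   ; (inj₂ arc)  → ∈-++⁺ʳ is (there (target arc)) }
    ; parent   = λ { (inj₁ p) (inj₁ q) → used-parent linked uS′ κS′ uis κS d∉ p q
                   ; (inj₂ p) (inj₂ q) → parent p q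
                   ; (inj₁ p) (inj₂ q) → ⊥-elim (apart p q)
                   ; (inj₂ p) (inj₁ q) → ⊥-elim (apart q p) }
    ; descend  = λ { s∈S (seg leaf) →
        let s′ , s′∈ , p = cross linked uS′ κS′ uis κS d∉ s∈S
            v , κv , q   = descend s′∈ leaf
        in v , κv , Star-gmap id inj₂ q ◅◅ Star-gmap id inj₁ p }
    }
    where
    parts : Unique (c ∷ is) × Unique (d ∷ body t) × Disjoint (c ∷ is) (d ∷ body t)
    parts = unique-++⁻ (c ∷ is) u
    uis : Unique (c ∷ is)
    uis = proj₁ parts
    d∉ : d ∉ c ∷ is
    d∉ i = proj₂ (proj₂ parts) (i , here ≡-refl)
    open Branching (branching t (proj₁ (proj₂ parts)) κS′ packed)
    apart : ∀ {u u′ w} → Used linked u w → Arc u′ w → ⊥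
    apart used arc with ∈-++⁻ is (link-target is {[]} (proj₁ (used-link linked used)))
    ... | inj₁ i = proj₂ (proj₂ parts) (there i , there (target arc))
    ... | inj₂ (here κw≡d) = Unique.Unique[x∷xs]⇒x∉xs (proj₁ (proj₂ parts)) (subst (_∈ body t) κw≡d (target arc))
  branching {c} (fork t₁ t₂) {S} (c∉ ∷ u) κS (packed₁ , packed₂) = record
    { Arc      = λ u w → B₁.Arc u w ⊎ B₂.Arc u w
    ; adjacent = λ { (inj₁ a) → B₁.adjacent a ; (inj₂ a) → B₂.adjacent a }
    ; target   = λ { (inj₁ a) → ∈-++⁺ˡ (B₁.target a) ; (inj₂ a) → ∈-++⁺ʳ (body t₁) (B₂.target a) }
    ; parent   = λ { (inj₁ p) (inj₁ q) → B₁.parent p q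
                   ; (inj₂ p) (inj₂ q) → B₂.parent p q
                   ; (inj₁ p) (inj₂ q) → ⊥-elim (proj₂ (proj₂ parts) (B₁.target p , B₂.target q))
                   ; (inj₂ p) (inj₁ q) → ⊥-elim (proj₂ (proj₂ parts) (B₁.target q , B₂.target p)) }
    ; descend  = λ { s∈S (forkˡ leaf) → let v , κv , p = B₁.descend s∈S leaf in v , κv , Star-gmap id inj₁ p
                   ; s∈S (forkʳ leaf) → let v , κv , p = B₂.descend s∈S leaf in v , κv , Star-gmap id inj₂ p }
    }
    where
    parts : Unique (body t₁) × Unique (body t₂) × Disjoint (body t₁) (body t₂)
    parts = unique-++⁻ (body t₁) u
    module B₁ = Branching (branching t₁ (All.++⁻ˡ (body t₁) c∉ ∷ proj₁ parts) κS packed₁)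
    module B₂ = Branching (branching t₂ (All.++⁻ʳ (body t₁) c∉ ∷ proj₁ (proj₂ parts)) κS packed₂)

-- Paths as lists, and the shortening of walks.

data Path {A : Set} (R : A → A → Set) : A → List A → A → Set where
  []  : ∀ {x} → Path R x [] x
  _∷_ : ∀ {x y ys z} → R x y → Path R y ys z → Path R x (y ∷ ys) z

module _ {A : Set} {R : A → A → Set} where

  snoc : ∀ {x ys y z} → Path R x ys y → R y z → Path R x (ys ++ z ∷ []) z
  snoc []      r = r ∷ []
  snoc (q ∷ p) r = q ∷ snoc p r

  truncate : ∀ {x ys y z} → Path R x ys y → z ∈ ys → ∃₂ λ zs rest → ys ≡ zs ++ rest × Path R x zs z
  truncate (r ∷ p) (here ≡-refl) = _ , _ , ≡-refl , r ∷ []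
  truncate (r ∷ p) (there i) with truncate p i
  ... | zs , rest , ≡-refl , q = _ ∷ zs , rest , ≡-refl , r ∷ q

  path-map : ∀ {R′ : A → A → Set} → (∀ {x y} → R x y → R′ x y) →
             ∀ {x ys y} → Path R x ys y → Path R′ x ys y
  path-map f []      = []
  path-map f (r ∷ p) = f r ∷ path-map f p

  lookup-end : ∀ {x ys y} → Path R x ys y → lookup (x ∷ ys) (fromℕ (length ys)) ≡ y
  lookup-end []      = ≡-refl
  lookup-end (_ ∷ p) = lookup-end p

  lookup-step : ∀ {x ys y} → Path R x ys y → (k : Fin (length ys)) →
                R (lookup (x ∷ ys) (inject₁ k)) (lookup (x ∷ ys) (suc k))
  lookup-step (r ∷ p) zero    = r
  lookup-step (_ ∷ p) (suc k) = lookup-step p k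

lookup-∈ : {A : Set} (xs : List A) (k : Fin (length xs)) → lookup xs k ∈ xs
lookup-∈ (x ∷ xs) zero    = here ≡-refl
lookup-∈ (x ∷ xs) (suc k) = there (lookup-∈ xs k)

lookup-injective : {A : Set} {xs : List A} → Unique xs → ∀ k l → lookup xs k ≡ lookup xs l → k ≡ l
lookup-injective {xs = x ∷ xs} (x∉ ∷ u) zero    zero    _  = ≡-refl
lookup-injective {xs = x ∷ xs} (x∉ ∷ u) zero    (suc l) eq = ⊥-elim (All.lookup x∉ (lookup-∈ xs l) eq)
lookup-injective {xs = x ∷ xs} (x∉ ∷ u) (suc k) zero    eq = ⊥-elim (All.lookup x∉ (lookup-∈ xs k) (≡-sym eq))
lookup-injective {xs = x ∷ xs} (x∉ ∷ u) (suc k) (suc l) eq = cong suc (lookup-injective u k l eq)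

module _ {n} {R : Fin n → Fin n → Set} (B : List (Fin n)) where

  open DecMembership {A = Fin n} _≟_ using (_∈?_)

  -- A path that starts in `B`, leaves it at once and never returns, without repeated vertices: the
  -- form in which a new branch can be attached to a tree occupying `B`.
  Ear : Fin n → Set
  Ear y = ∃₂ λ x ys → x ∈ B × Path R x ys y × Unique ys × Disjoint ys B

  -- Detours are erased as they arise: a step into `B` restarts the ear there, a step onto the ear
  -- cuts it back, and any other step lengthens it.
  extend-ear : ∀ {y z} → Ear y → R y z → Ear z
  extend-ear {y} {z} (x , ys , x∈B , p , u , disjoint) r with z ∈? B
  ... | yes z∈B = z , [] , z∈B , [] , [] , λ ()
  ... | no  z∉B with z ∈? ys
  ...   | yes z∈ys with truncate p z∈ys
  ...     | zs , rest , ≡-refl , q =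
    x , zs , x∈B , q , proj₁ (unique-++⁻ zs u) , λ (i , j) → disjoint (∈-++⁺ˡ i , j)
  extend-ear {y} {z} (x , ys , x∈B , p , u , disjoint) r | no z∉B | no z∉ys =
    x , ys ++ z ∷ [] , x∈B , snoc p r
    , Unique.++⁺ u ([] ∷ []) (λ { (i , here ≡-refl) → z∉ys i }) , disjoint′
    where
    disjoint′ : Disjoint (ys ++ z ∷ []) B
    disjoint′ (i , j) with ∈-++⁻ ys i
    ... | inj₁ k             = disjoint (k , j)
    ... | inj₂ (here ≡-refl) = z∉B j

  ear : ∀ {y z} → Ear y → Star R y z → Ear z
  ear e ε       = e
  ear e (r ◅ p) = ear (extend-ear e r) p

-- A tree of classes through given terminals, and the family of disjoint connected sets.

module Families {n} (adj : Fin n → Fin n → Bool) (adj-sym : ∀ u v → adj u v ≡ adj v u)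
  (κ : Fin n → Fin n) (τ : ℕ) where

  open Colours adj κ τ
  open Trees adj κ τ
  private V = Fin n

  split-chain : ∀ {c is d x} → Chain c is d → x ∈ is →
                ∃₂ λ is₁ is₂ → is ≡ is₁ ++ x ∷ is₂ × Chain c is₁ x × Chain x is₂ d
  split-chain (q ∷ ch) (here ≡-refl) = [] , _ , ≡-refl , one q , ch
  split-chain (q ∷ ch) (there i) with split-chain ch i
  ... | is₁ , is₂ , ≡-refl , ch₁ , ch₂ = _ ∷ is₁ , is₂ , ≡-refl , q ∷ ch₁ , ch₂

  path-chain : ∀ {c e es d} → c ⇝ e → Path _⇝_ e es d → ∃ λ is → e ∷ es ≡ is ++ d ∷ [] × Chain c is d
  path-chain q []       = [] , ≡-refl , one q
  path-chain q (q′ ∷ p) with path-chain q′ p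
  ... | is , eq , ch = _ ∷ is , cong (_ ∷_) eq , q ∷ ch

  -- The additional 1 in `cost-≤` pays for a chain that is cut into two segments when `x` lies in
  -- its interior.
  record Graft {c x} (t : Tree c) (sub : Tree x) : Set where
    field
      tree     : Tree c
      body-↭   : body tree ↭ body t ++ body sub
      cost-≤   : cost tree ≤ suc (cost t + cost sub)
      keep     : ∀ {a} → Leaf a t → Leaf a tree
      new      : ∀ {a} → Leaf a sub → Leaf a tree

  graft : ∀ {c x} (t : Tree c) → x ∈ c ∷ body t → (sub : Tree x) → Graft t sub
  graft t (here ≡-refl) sub = record
    { tree = fork t sub ; body-↭ = refl ; cost-≤ = n≤1+n _ ; keep = forkˡ ; new = forkʳ }
  graft (seg {is = is} {d} ch t) (there i) sub with ∈-++⁻ is i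
  ... | inj₁ i′ with split-chain ch i′
  ...   | is₁ , is₂ , ≡-refl , ch₁ , ch₂ = record
    { tree   = seg ch₁ (fork (seg ch₂ t) sub)
    ; body-↭ = ↭-reflexive (≡-trans (cong (λ l → is₁ ++ _ ∷ l) (++-assoc is₂ (d ∷ body t) (body sub)))
        (≡-trans (≡-sym (++-assoc is₁ (_ ∷ is₂) _)) (≡-sym (++-assoc (is₁ ++ _ ∷ is₂) (d ∷ body t) (body sub)))))
    ; cost-≤ = ≤-refl
    ; keep   = λ { (seg leaf) → seg (forkˡ (seg leaf)) }
    ; new    = λ leaf → seg (forkʳ leaf)
    }
  graft (seg {is = is} {d} ch t) (there _) sub | inj₂ i′ = record
    { tree   = seg ch tree
    ; body-↭ = ↭-trans (Perm.++⁺ˡ is (prep d body-↭)) (↭-reflexive (≡-sym (++-assoc is (d ∷ body t) (body sub))))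
    ; cost-≤ = s≤s cost-≤
    ; keep   = λ { (seg leaf) → seg (keep leaf) }
    ; new    = λ leaf → seg (new leaf)
    }
    where open Graft (graft t i′ sub)
  graft (fork t₁ t₂) (there i) sub with ∈-++⁻ (body t₁) i
  ... | inj₁ i′ = record
    { tree   = fork tree t₂
    ; body-↭ = begin
        body tree ++ body t₂               ↭⟨ Perm.++⁺ʳ (body t₂) body-↭ ⟩
        (body t₁ ++ body sub) ++ body t₂   ≡⟨ ++-assoc (body t₁) _ _ ⟩
        body t₁ ++ body sub ++ body t₂     ↭⟨ Perm.++⁺ˡ (body t₁) (Perm.++-comm (body sub) (body t₂)) ⟩
        body t₁ ++ body t₂ ++ body sub     ≡⟨ ++-assoc (body t₁) _ _ ⟨
        (body t₁ ++ body t₂) ++ body sub   ∎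
    ; cost-≤ = ≤-trans (+-monoˡ-≤ (cost t₂) cost-≤) (≤-reflexive (cong suc (xy∙z≈xz∙y (cost t₁) (cost sub) (cost t₂))))
    ; keep   = λ { (forkˡ leaf) → forkˡ (keep leaf) ; (forkʳ leaf) → forkʳ leaf }
    ; new    = forkˡ ∘ new
    }
    where
    open Graft (graft t₁ (there i′) sub)
    open PermutationReasoning
    open CommutativeSemigroup +-commutativeSemigroup using (xy∙z≈xz∙y)
  ... | inj₂ i′ = record
    { tree   = fork t₁ tree
    ; body-↭ = ↭-trans (Perm.++⁺ˡ (body t₁) body-↭) (↭-reflexive (≡-sym (++-assoc (body t₁) _ _)))
    ; cost-≤ = ≤-trans (+-monoʳ-≤ (cost t₁) cost-≤)
        (≤-reflexive (≡-trans (+-suc (cost t₁) _) (cong suc (≡-sym (+-assoc (cost t₁) _ _)))))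
    ; keep   = λ { (forkˡ leaf) → forkˡ leaf ; (forkʳ leaf) → forkʳ (keep leaf) }
    ; new    = forkʳ ∘ new
    }
    where open Graft (graft t₂ (there i′) sub)

  path-tree : ∀ {x ys y} → Path _⇝_ x ys y →
              ∃ λ (sub : Tree x) → body sub ≡ ys × cost sub ≤ 2 × Leaf y sub
  path-tree []      = stop , ≡-refl , s≤s z≤n , stop
  path-tree (q ∷ p) with path-chain q p
  ... | is , eq , ch = seg ch stop , ≡-sym eq , ≤-refl , seg stop

  -- The walk to `y` is shortened to an ear of the classes of `t`, which is then grafted. The price
  -- 3 is one segment, one leaf and possibly one chain cut in two.
  add-leaf : ∀ {c y} (t : Tree c) → Unique (c ∷ body t) → Star _⇝_ c y →
             ∃ λ (t′ : Tree c) → Unique (c ∷ body t′) × cost t′ ≤ 3 + cost t ×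
               (∀ {a} → Leaf a t → Leaf a t′) × Leaf y t′
  add-leaf {c} t u p with ear (c ∷ body t) (c , [] , here ≡-refl , [] , [] , λ ()) p
  ... | x , ys , x∈ , q , uys , disjoint with path-tree q
  ...   | sub , ≡-refl , cost-sub , leaf =
    tree , unique-↭ (prep c (↭-sym body-↭)) (Unique.++⁺ u uys (λ (i , j) → disjoint (j , i)))
    , ≤-trans cost-≤ (s≤s (≤-trans (+-monoʳ-≤ (cost t) cost-sub) (≤-reflexive (+-comm (cost t) 2))))
    , keep , new leaf
    where open Graft (graft t x∈ sub)

  spanning-tree : ∀ {c} h (ys : Fin h → V) → (∀ i → Star _⇝_ c (ys i)) →
    ∃ λ (t : Tree c) → Unique (c ∷ body t) × cost t ≤ h * 3 + 1 × Leaf c t × (∀ i → Leaf (ys i) t)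
  -- The initial `stop` accounts for the summand 1 and stays a leaf at the root class.
  spanning-tree zero    ys p = stop , [] ∷ [] , ≤-refl , stop , λ ()
  spanning-tree (suc h) ys p with spanning-tree h (ys ∘ suc) (p ∘ suc)
  ... | t , u , cost-t , leaf-c , leaves with add-leaf t u (p zero)
  ...   | t′ , u′ , cost-t′ , keep , leaf =
    t′ , u′ , ≤-trans cost-t′ (s≤s (s≤s (s≤s cost-t))) , keep leaf-c , λ { zero → leaf ; (suc i) → keep (leaves i) }

  big-interior : ∀ {c is d} → Chain c is d → All (λ e → τ < size e) is
  big-interior (one _)  = []
  big-interior (q ∷ ch) = proj₂ q ∷ big-interior ch

  big-body : ∀ {c} (t : Tree c) → All (λ e → τ < size e) (body t)
  big-body stop         = []
  big-body (seg ch t)   = All.++⁺ (big-interior ch) (chain-big ch ∷ big-body t)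
  big-body (fork t₁ t₂) = All.++⁺ (big-body t₁) (big-body t₂)

  -- Disjoint sets, each of which connects any two of the prescribed classes by a path of its own.
  -- `big` will keep them away from the branch vertices, whose classes are small.
  record Family (K : ℕ) {h} (ys : Fin h → V) : Set₁ where
    field
      Member   : Fin K → V → Set
      disjoint : ∀ {q q′ v} → Member q v → Member q′ v → q ≡ q′
      big      : ∀ {q v} → Member q v → τ < size (κ v)
      join     : ∀ q i j → ∃₂ λ a l → ∃ λ b →
                 κ a ≡ ys i × κ b ≡ ys j × Path (λ u w → adj u w ≡ true) a l b ×
                 Unique (a ∷ l) × All (Member q) (a ∷ l)

  -- The class with index `zero` is the root, so only the other `h` classes cost 3 each. The members
  -- are the sets of descendants of the packed roots.
  family : ∀ {c} h (ys : Fin (suc h) → V) → ys zero ≡ c → τ < size c → (∀ i → Star _⇝_ c (ys i)) →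
           ∀ K → (h * 3 + 1) * K ≤ τ → Family K ys
  family {c} h ys ys₀ big-c reach K bound with spanning-tree h (ys ∘ suc) (reach ∘ suc)
  ... | t , u , cost-t , leaf-c , leaves with packing t big-c K (≤-trans (*-monoˡ-≤ K cost-t) bound)
  ...   | S , ≡-refl , κS , uS , packed = record
    { Member   = Member
    ; disjoint = λ {q} {q′} p p′ → lookup-injective uS q q′ (same-root (root q) (root q′) p p′)
    ; big      = λ p → All.lookup (big-c ∷ big-body t) (colour p)
    ; join     = join
    }
    where
    open Branching (branching t u κS packed)
    Member : Fin (length S) → V → Set
    Member q v = Star (flip Arc) v (lookup S q)

    root : ∀ q → κ (lookup S q) ≡ c
    root q = All.lookup κS (lookup-∈ S q)

    colour : ∀ {q v} → Member q v → κ v ∈ c ∷ body t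
    colour {q} ε  = here (root q)
    colour (f ◅ _) = there (target f)

    c∉ : c ∉ body t
    c∉ = Unique.Unique[x∷xs]⇒x∉xs u

    -- Unique parents keep two climbs from `v` together, and neither can pass through the end of the
    -- other because no arc enters the root class.
    same-root : ∀ {v s s′} → κ s ≡ c → κ s′ ≡ c → Star (flip Arc) v s → Star (flip Arc) v s′ → s ≡ s′
    same-root κs κs′ ε ε = ≡-refl
    same-root κs κs′ ε (f ◅ _) = contradiction (subst (_∈ body t) κs (target f)) c∉
    same-root κs κs′ (f ◅ _) ε = contradiction (subst (_∈ body t) κs′ (target f)) c∉
    same-root κs κs′ (f ◅ p) (g ◅ p′) with parent f g
    ... | ≡-refl = same-root κs κs′ p p′

    Step : Fin (length S) → V → V → Set
    Step q u w = adj u w ≡ true × Member q w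

    ascend : ∀ {q v} → Member q v → Star (Step q) v (lookup S q)
    ascend ε       = ε
    ascend (_◅_ {i = v} {j = u} f p) = (≡-trans (adj-sym v u) (adjacent f) , p) ◅ ascend p

    climb-down : ∀ {q v} → Member q v → Star (Step q) (lookup S q) v
    climb-down ε       = ε
    climb-down (f ◅ p) = climb-down p ◅◅ (adjacent f , f ◅ p) ◅ ε

    leaf-of : ∀ i → Leaf (ys i) t
    leaf-of zero    = subst (λ a → Leaf a t) (≡-sym ys₀) leaf-c
    leaf-of (suc i) = leaves i

    members-path : ∀ {q a l b} → Path (Step q) a l b → All (Member q) l
    members-path []      = []
    members-path (r ∷ p) = proj₂ r ∷ members-path p

    join : ∀ q i j → ∃₂ λ a l → ∃ λ b →
           κ a ≡ ys i × κ b ≡ ys j × Path (λ u w → adj u w ≡ true) a l b ×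
           Unique (a ∷ l) × All (Member q) (a ∷ l)
    join q i j with descend (lookup-∈ S q) (leaf-of i) | descend (lookup-∈ S q) (leaf-of j)
    ... | a , κa , p | b , κb , p′
      -- An ear of the single vertex `a` turns the walk from `a` up to the root and down to `b` into
      -- a simple path starting at `a`.
      with ear (a ∷ []) (a , [] , here ≡-refl , [] , [] , λ ()) (ascend p ◅◅ climb-down p′)
    ...   | x , l , here ≡-refl , path , ul , l∌a =
      a , l , b , κa , κb , path-map proj₁ path
      , unique-∷ (λ i → l∌a (i , here ≡-refl)) ul , p ∷ members-path path

-- Double counting in biregular graphs.

-- Both sides count edges: `d₁` for each vertex of `X`, and all of these edges end in `Y`, whose
-- vertices receive `d₂` each.
edge-count : {A B : Set} (E : A → B → Bool) (xs : List A) (ys : List B) → ∀ {d₁ d₂} (X : A → Bool) (Y : B → Bool) →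
  (∀ {u} → u ∈ xs → cnt (E u) ys ≡ d₁) → (∀ {w} → w ∈ ys → cnt (λ u → E u w) xs ≡ d₂) →
  (∀ {u w} → u ∈ xs → w ∈ ys → X u ≡ true → E u w ≡ true → Y w ≡ true) →
  cnt X xs * d₁ ≤ cnt Y ys * d₂
edge-count E xs ys {d₁} {d₂} X Y deg₁ deg₂ XY = begin
  cnt X xs * d₁
    ≡⟨ ∑-*ʳ xs _ d₁ ⟩
  ∑ xs (λ u → ind (X u) * d₁)
    ≤⟨ ∑-mono xs (λ {u} i → ≤-reflexive (cong (ind (X u) *_) (≡-sym (deg₁ i)))) ⟩
  ∑ xs (λ u → ind (X u) * cnt (E u) ys)
    ≤⟨ ∑-mono xs (λ {u} _ → ≤-reflexive (≡-trans (*-comm (ind (X u)) _) (∑-*ʳ ys _ (ind (X u))))) ⟩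
  ∑ xs (λ u → ∑ ys (λ w → ind (E u w) * ind (X u)))
    ≤⟨ ∑-mono xs (λ {u} i → ∑-mono ys λ {w} j → transfer (E u w) (X u) (Y w) (λ Xu e → XY i j Xu e)) ⟩
  ∑ xs (λ u → ∑ ys (λ w → ind (E u w) * ind (Y w)))
    ≡⟨ ∑-swap xs ys _ ⟩
  ∑ ys (λ w → ∑ xs (λ u → ind (E u w) * ind (Y w)))
    ≤⟨ ∑-mono ys (λ {w} _ → ≤-reflexive (≡-trans (≡-sym (∑-*ʳ xs _ (ind (Y w)))) (*-comm _ (ind (Y w))))) ⟩
  ∑ ys (λ w → ind (Y w) * cnt (λ u → E u w) xs)
    ≤⟨ ∑-mono ys (λ {w} i → ≤-reflexive (cong (ind (Y w) *_) (deg₂ i))) ⟩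
  ∑ ys (λ w → ind (Y w) * d₂)
    ≡⟨ ∑-*ʳ ys _ d₂ ⟨
  cnt Y ys * d₂ ∎
  where
  open ≤-Reasoning
  transfer : ∀ e x y → (x ≡ true → e ≡ true → y ≡ true) → ind e * ind x ≤ ind e * ind y
  transfer false x y f = z≤n
  transfer true  x y f = *-monoʳ-≤ 1 (ind-mono λ x≡true → f x≡true ≡-refl)

-- Combines `edge-count` for `X` and `Y` with `edge-count` in the reverse direction on the full
-- vertex sets; this eliminates `d₂`, and the positive factor `d₁` cancels.
biregular : {A B : Set} (E : A → B → Bool) (xs : List A) (ys : List B) → ∀ {d₁ d₂} →
  (∀ {u} → u ∈ xs → cnt (E u) ys ≡ d₁) → (∀ {w} → w ∈ ys → cnt (λ u → E u w) xs ≡ d₂) →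
  0 < d₁ → (X : A → Bool) (Y : B → Bool) →
  (∀ {u w} → u ∈ xs → w ∈ ys → X u ≡ true → E u w ≡ true → Y w ≡ true) →
  cnt X xs * length ys ≤ cnt Y ys * length xs
biregular E xs ys {d₁} {d₂} deg₁ deg₂ d₁>0 X Y XY = *-cancelʳ-≤ _ _ d₁ {{>-nonZero d₁>0}} (begin
  (cnt X xs * length ys) * d₁ ≡⟨ xy∙z≈xz∙y (cnt X xs) _ _ ⟩
  (cnt X xs * d₁) * length ys ≤⟨ *-monoˡ-≤ (length ys) (edge-count E xs ys X Y deg₁ deg₂ XY) ⟩
  (cnt Y ys * d₂) * length ys ≡⟨ *-assoc (cnt Y ys) _ _ ⟩
  cnt Y ys * (d₂ * length ys) ≤⟨ *-monoʳ-≤ (cnt Y ys) total ⟩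
  cnt Y ys * (length xs * d₁) ≡⟨ *-assoc (cnt Y ys) _ _ ⟨
  (cnt Y ys * length xs) * d₁ ∎)
  where
  open ≤-Reasoning
  open CommutativeSemigroup *-commutativeSemigroup using (xy∙z≈xz∙y)
  total : d₂ * length ys ≤ length xs * d₁
  total = begin
    d₂ * length ys           ≡⟨ *-comm d₂ _ ⟩
    length ys * d₂           ≡⟨ cong (_* d₂) (cnt-true ys) ⟨
    cnt (λ _ → true) ys * d₂ ≤⟨ edge-count (flip E) ys xs _ _ deg₂ deg₁ (λ _ _ _ _ → ≡-refl) ⟩
    cnt (λ _ → true) xs * d₁ ≡⟨ cong (_* d₁) (cnt-true xs) ⟩
    length xs * d₁           ∎

-- Boolean definitions as propositions; partitions and individualization.

bool-ext : ∀ {a b} → (a ≡ true → b ≡ true) → (b ≡ true → a ≡ true) → a ≡ b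
bool-ext {true}  {b}     f g = ≡-sym (f ≡-refl)
bool-ext {false} {true}  f g = g ≡-refl
bool-ext {false} {false} f g = ≡-refl

∧-intro : ∀ {a b} → a ≡ true → b ≡ true → a ∧ b ≡ true
∧-intro ≡-refl ≡-refl = ≡-refl

∧₄-intro : ∀ {a b c d} → a ≡ true → b ≡ true → c ≡ true → d ≡ true → a ∧ b ∧ c ∧ d ≡ true
∧₄-intro ≡-refl ≡-refl ≡-refl ≡-refl = ≡-refl

∧₄-elim : ∀ {a b c d} → a ∧ b ∧ c ∧ d ≡ true → a ≡ true × b ≡ true × c ≡ true × d ≡ true
∧₄-elim {true} {true} {true} {true} _ = ≡-refl , ≡-refl , ≡-refl , ≡-refl

≡ᵇ-sound : ∀ {a b} → (a ≡ᵇ b) ≡ true → a ≡ b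
≡ᵇ-sound {a} {b} eq = ≡ᵇ⇒≡ a b (subst T (≡-sym eq) tt)

≡ᵇ-refl : ∀ a → (a ≡ᵇ a) ≡ true
≡ᵇ-refl zero    = ≡-refl
≡ᵇ-refl (suc a) = ≡ᵇ-refl a

cnt-cong : {A : Set} {p q : A → Bool} (xs : List A) → (∀ {x} → p x ≡ q x) → cnt p xs ≡ cnt q xs
cnt-cong xs p≗q = ≤-antisym (cnt-mono xs λ _ → ≡-trans (≡-sym p≗q)) (cnt-mono xs λ _ → ≡-trans p≗q)

count-cnt : ∀ {n} (p : Fin n → Bool) → count p ≡ cnt p (allFin n)
count-cnt {n} p = ≡-trans (go p) (cong sum (≡-sym (map-tabulate id (ind ∘ p))))
  where
  go : ∀ {n} (p : Fin n → Bool) → count p ≡ sum (tabulate (ind ∘ p))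
  go {zero}  p = ≡-refl
  go {suc n} p = cong (ind (p zero) +_) (go (p ∘ suc))

allV-elim : ∀ {n} {p : Fin n → Bool} → allV p ≡ true → ∀ i → p i ≡ true
allV-elim {suc n} eq zero    = proj₁ (∧-true eq)
allV-elim {suc n} eq (suc i) = allV-elim (proj₂ (∧-true eq)) i

allV-intro : ∀ {n} {p : Fin n → Bool} → (∀ i → p i ≡ true) → allV p ≡ true
allV-intro {zero}  f = ≡-refl
allV-intro {suc n} f = ∧-intro (f zero) (allV-intro (f ∘ suc))

anyV-elim : ∀ {n} {p : Fin n → Bool} → anyV p ≡ true → ∃ λ i → p i ≡ true
anyV-elim {suc n} {p} eq with p zero in p₀
... | true  = zero , p₀
... | false = let i , pi = anyV-elim eq in suc i , pi

samePart-elim : ∀ {n} (R S : Coloring n) → samePart R S ≡ true → ∀ v w → R v w ≡ S v w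
samePart-elim R S eq v w = eqB-sound (R v w) (allV-elim (allV-elim eq v) w)
  where
  eqB-sound : ∀ a {b} → eqB a b ≡ true → a ≡ b
  eqB-sound true           b≡true = ≡-sym b≡true
  eqB-sound false {false} _      = ≡-refl

record IsPartition {n} (R : Coloring n) : Set where
  field
    reflexive  : ∀ v → R v v ≡ true
    symmetric  : ∀ {v w} → R v w ≡ true → R w v ≡ true
    transitive : ∀ {u v w} → R u v ≡ true → R v w ≡ true → R u w ≡ true

partition-cong : ∀ {n} {R S : Coloring n} → (∀ v w → S v w ≡ R v w) → IsPartition R → IsPartition S
partition-cong S≗R P = record
  { reflexive  = λ v → ≡-trans (S≗R v v) (reflexive v)
  ; symmetric  = λ {v} {w} p → ≡-trans (S≗R w v) (symmetric (≡-trans (≡-sym (S≗R v w)) p))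
  ; transitive = λ {u} {v} {w} p q → ≡-trans (S≗R u w)
      (transitive (≡-trans (≡-sym (S≗R u v)) p) (≡-trans (≡-sym (S≗R v w)) q))
  }
  where open IsPartition P

individualize-elim : ∀ {n} (Y : Subset n) (R : Coloring n) {v w} → individualize Y R v w ≡ true →
                     (Y v ≡ true × Y w ≡ true × v ≡ w) ⊎ (Y v ≡ false × Y w ≡ false × R v w ≡ true)
individualize-elim Y R {v} {w} eq with Y v | Y w
... | true  | true  with v ≟ w
...   | yes v≡w = inj₁ (≡-refl , ≡-refl , v≡w)
individualize-elim Y R () | true | true | no _
individualize-elim Y R () | true | false
individualize-elim Y R () | false | true
individualize-elim Y R eq | false | false = inj₂ (≡-refl , ≡-refl , eq)

individualize-same : ∀ {n} (Y : Subset n) (R : Coloring n) {v} → R v v ≡ true → individualize Y R v v ≡ true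
individualize-same Y R {v} Rvv with Y v
... | true rewrite complete (v ≟ v) ≡-refl = ≡-refl
... | false = Rvv

individualize-outside : ∀ {n} (Y : Subset n) (R : Coloring n) {v w} →
  Y v ≡ false → Y w ≡ false → R v w ≡ true → individualize Y R v w ≡ true
individualize-outside Y R ¬Yv ¬Yw Rvw rewrite ¬Yv | ¬Yw = Rvw

individualize-partition : ∀ {n} (Y : Subset n) {R : Coloring n} → IsPartition R →
                          IsPartition (individualize Y R)
individualize-partition Y {R} P = record
  { reflexive  = λ v → individualize-same Y R (reflexive v)
  ; symmetric  = symm
  ; transitive = tran
  }
  where
  open IsPartition P
  symm : ∀ {v w} → individualize Y R v w ≡ true → individualize Y R w v ≡ true
  symm {v} {w} eq with individualize-elim Y R eq
  ... | inj₁ (_ , _ , ≡-refl)      = eq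
  ... | inj₂ (¬Yv , ¬Yw , Rvw)     = individualize-outside Y R ¬Yw ¬Yv (symmetric Rvw)
  tran : ∀ {u v w} → individualize Y R u v ≡ true → individualize Y R v w ≡ true →
         individualize Y R u w ≡ true
  tran {u} {v} {w} p q with individualize-elim Y R p | individualize-elim Y R q
  ... | inj₁ (_ , _ , ≡-refl)  | _                      = q
  ... | inj₂ _                 | inj₁ (_ , _ , ≡-refl)  = p
  ... | inj₂ (¬Yu , _ , Ruv)   | inj₂ (_ , ¬Yw , Rvw)   =
    individualize-outside Y R ¬Yu ¬Yw (transitive Ruv Rvw)

-- Colour refinement and the closure sequence.

module Refinement {n} (G : Graph n) (χE : Fin n → Fin n → ℕ) where

  SameCounts : Coloring n → Fin n → Fin n → Set
  SameCounts R v w = ∀ x p q r s → mult G χE R v x p q r s ≡ mult G χE R w x p q r s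

  refine-elim : ∀ {R v w} → refine G χE R v w ≡ true → R v w ≡ true × SameCounts R v w
  refine-elim eq = proj₁ (∧-true eq) , λ x p q r s →
    ≡ᵇ-sound (allV-elim (allV-elim (allV-elim (allV-elim (allV-elim (proj₂ (∧-true eq)) x) p) q) r) s)

  refine-intro : ∀ {R v w} → R v w ≡ true → SameCounts R v w → refine G χE R v w ≡ true
  refine-intro {R} {v} {w} Rvw same = ∧-intro Rvw
    (allV-intro λ x → allV-intro λ p → allV-intro λ q → allV-intro λ r → allV-intro λ s →
      subst (λ k → (mult G χE R v x p q r s ≡ᵇ k) ≡ true) (same x p q r s)
        (≡ᵇ-refl (mult G χE R v x p q r s)))

  refine-partition : ∀ {R} → IsPartition R → IsPartition (refine G χE R)
  refine-partition {R} P = record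
    { reflexive  = λ v → refine-intro {R} (reflexive v) λ _ _ _ _ _ → ≡-refl
    ; symmetric  = λ eq → let Rvw , same = refine-elim {R} eq in
        refine-intro {R} (symmetric Rvw) λ x p q r s → ≡-sym (same x p q r s)
    ; transitive = λ eq eq′ → let Ruv , same = refine-elim {R} eq ; Rvw , same′ = refine-elim {R} eq′ in
        refine-intro {R} (transitive Ruv Rvw) λ x p q r s → ≡-trans (same x p q r s) (same′ x p q r s)
    }
    where open IsPartition P

  refIter-partition : ∀ {R} i → IsPartition R → IsPartition (refIter G χE i R)
  refIter-partition zero    P = P
  refIter-partition (suc i) P = refine-partition (refIter-partition i P)

  mult-cong : ∀ {R S} → (∀ v w → R v w ≡ S v w) →
              ∀ v x p q r s → mult G χE R v x p q r s ≡ mult G χE S v x p q r s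
  mult-cong {R} {S} R≗S v x p q r s =
    ≡-trans (count-cnt {n} _) (≡-trans (cnt-cong (allFin n) λ {u} →
      cong (λ b → adj G v u ∧ b ∧ (χE v u ≡ᵇ χE p q) ∧ (χE u v ≡ᵇ χE r s)) (R≗S u x))
      (≡-sym (count-cnt {n} _)))

  -- Refining once more after the last round separates nothing, so vertices that are still related
  -- must have equal counts.
  wl1-stable : ∀ {R S} → IsWL1 G χE R S → ∀ {v w} → S v w ≡ true → SameCounts S v w
  wl1-stable {R} {S} (i , stable , _ , S≗) {v} {w} Svw x p q r s = begin
    mult G χE S v x p q r s                 ≡⟨ mult-cong S≗ v x p q r s ⟩
    mult G χE (refIter G χE i R) v x p q r s ≡⟨ proj₂ (refine-elim {refIter G χE i R} refined) x p q r s ⟩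
    mult G χE (refIter G χE i R) w x p q r s ≡⟨ mult-cong S≗ w x p q r s ⟨
    mult G χE S w x p q r s                 ∎
    where
    open ≡-Reasoning
    refined : refine G χE (refIter G χE i R) v w ≡ true
    refined = ≡-trans (≡-sym (samePart-elim (refIter G χE i R) (refIter G χE (suc i) R) stable v w)) (≡-trans (≡-sym (S≗ v w)) Svw)

  record IsClosed (t : ℕ) (R : Coloring n) : Set where
    field
      partition  : IsPartition R
      equitable  : ∀ {v w} → R v w ≡ true → SameCounts R v w
      singleton  : ∀ {v w} → classSize R v ≤ t → R v w ≡ true → v ≡ w

  module _ {χV X t c} (closure : IsClosureSeq G χV χE X t c) where

    private
      double-suc : ∀ i → 2 * suc i ≡ suc (suc (2 * i))
      double-suc i = cong suc (+-suc i (i + 0))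

      wl1-partition : ∀ {R S} → IsWL1 G χE R S → IsPartition R → IsPartition S
      wl1-partition (i , _ , _ , S≗) P = partition-cong S≗ (refIter-partition i P)

      even : ∀ i → IsPartition (c (2 * i))
      odd  : ∀ i → IsPartition (c (suc (2 * i)))
      even zero    = partition-cong (proj₁ closure) (individualize-partition X record
        { reflexive  = λ v → ≡ᵇ-refl (χV v)
        ; symmetric  = λ {v} {w} p → subst (λ k → (χV w ≡ᵇ k) ≡ true) (≡-sym (≡ᵇ-sound p)) (≡ᵇ-refl (χV w))
        ; transitive = λ {u} {v} {w} p q →
            subst (λ k → (χV u ≡ᵇ k) ≡ true) (≡-trans (≡ᵇ-sound p) (≡ᵇ-sound q)) (≡ᵇ-refl (χV u))
        })
      even (suc i) = subst (IsPartition ∘ c) (≡-sym (double-suc i))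
        (partition-cong (proj₂ (proj₂ closure) i) (individualize-partition (smallClass t (c (suc (2 * i)))) (odd i)))
      odd i = wl1-partition (proj₁ (proj₂ closure) i) (even i)

    closed : ∀ i → IsStableIndex c i → IsClosed t (c (suc (2 * i)))
    closed i stable = record
      { partition = odd i
      ; equitable = wl1-stable (proj₁ (proj₂ closure) i)
      ; singleton = single
      }
      where
      -- The stable index `i` may have either parity. The odd index `j` lies beyond it, is the
      -- outcome of a refinement, and is followed by an individualization of small classes that
      -- changes nothing.
      j = suc (2 * i)
      i≤j : i ≤ j
      i≤j = ≤-trans (m≤m+n i _) (n≤1+n _)
      single : ∀ {v w} → classSize (c j) v ≤ t → c j v w ≡ true → v ≡ w
      single {v} {w} small cvw with individualize-elim (smallClass t (c j)) (c j) ind-vw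
        where
        ind-vw : individualize (smallClass t (c j)) (c j) v w ≡ true
        ind-vw = begin
          individualize (smallClass t (c j)) (c j) v w ≡⟨ proj₂ (proj₂ closure) i v w ⟨
          c (suc j) v w ≡⟨ samePart-elim (c i) (c (suc j)) (stable (suc j) (≤-trans i≤j (n≤1+n j))) v w ⟨
          c i v w       ≡⟨ samePart-elim (c i) (c j) (stable j i≤j) v w ⟩
          c j v w       ≡⟨ cvw ⟩
          true          ∎
          where open ≡-Reasoning
      ... | inj₁ (_ , _ , v≡w) = v≡w
      ... | inj₂ (large , _)   = ⊥-elim (subst T large (≤⇒≤ᵇ small))

-- Classes of a closed colouring.

module Representatives {n} {R : Coloring n} (P : IsPartition R) where

  open IsPartition P

  first : (Fin n → Bool) → List (Fin n) → Fin n → Fin n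
  first p []       d = d
  first p (x ∷ xs) d = if p x then x else first p xs d

  first-satisfies : ∀ (p : Fin n → Bool) {xs d x} → x ∈ xs → p x ≡ true → p (first p xs d) ≡ true
  first-satisfies p {x ∷ xs} i px with p x in eq
  ... | true = eq
  first-satisfies p (here ≡-refl) px | false = ⊥-elim (false≢true eq px)
  first-satisfies p (there i)     px | false = first-satisfies p i px

  first-cong : ∀ (p q : Fin n → Bool) {xs d d′ x} → (∀ y → p y ≡ q y) → x ∈ xs → p x ≡ true →
               first p xs d ≡ first q xs d′
  first-cong p q {y ∷ xs} p≗q i px rewrite ≡-sym (p≗q y) with p y in eq
  ... | true = ≡-refl
  first-cong p q p≗q (here ≡-refl) px | false = ⊥-elim (false≢true eq px)
  first-cong p q p≗q (there i)     px | false = first-cong p q p≗q i px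

  -- The first member in a fixed order depends on the class alone. The default `v` is never returned
  -- by exhausting the list, since `v` occurs in it and is related to itself.
  representative : Fin n → Fin n
  representative v = first (R v) (allFin n) v

  related-representative : ∀ v → R v (representative v) ≡ true
  related-representative v = first-satisfies (R v) (∈-allFin v) (reflexive v)

  representative-cong : ∀ {v w} → R v w ≡ true → representative v ≡ representative w
  representative-cong {v} {w} Rvw = first-cong (R v) (R w)
    (λ y → bool-ext (transitive (symmetric Rvw)) (transitive Rvw)) (∈-allFin v) (reflexive v)

  representative-injective : ∀ {v w} → representative v ≡ representative w → R v w ≡ true
  representative-injective {v} {w} eq = transitive
    (subst (λ r → R v r ≡ true) eq (related-representative v)) (symmetric (related-representative w))

  related-eq : ∀ v w → R v w ≡ ⌊ representative v ≟ representative w ⌋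
  related-eq v w = bool-ext (λ Rvw → complete (_ ≟ _) (representative-cong Rvw))
    (λ eq → representative-injective (sound (representative v ≟ representative w) eq))

module ClosedColoring {n} (G : Graph n) (χE : Fin n → Fin n → ℕ) {t} {R : Coloring n}
  (isClosed : Refinement.IsClosed G χE t R) where

  private V = Fin n
  open Refinement.IsClosed isClosed
  open IsPartition partition
  open Representatives partition public
  open Colours (adj G) representative t public

  cnt-members : (p : V → Bool) (v : V) →
                cnt p (members (representative v)) ≡ count (λ w → R w v ∧ p w)
  cnt-members p v = ≡-trans (cnt-filter _ p (allFin n))
    (≡-trans (cnt-cong (allFin n) λ {w} → cong (_∧ p w) (≡-sym (related-eq w v)))
             (≡-sym (count-cnt {n} _)))

  size-class : ∀ v → size (representative v) ≡ classSize R v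
  size-class v = begin
    size (representative v)                         ≡⟨ cnt-true (members (representative v)) ⟨
    cnt (λ _ → true) (members (representative v))   ≡⟨ cnt-members _ v ⟩
    count (λ w → R w v ∧ true)                      ≡⟨ count-cnt {n} _ ⟩
    cnt (λ w → R w v ∧ true) (allFin n)             ≡⟨ cnt-cong (allFin n) (λ {w} → bool-ext
                                                         (symmetric ∘ proj₁ ∘ ∧-true)
                                                         (λ Rvw → ∧-intro (symmetric Rvw) ≡-refl)) ⟩
    cnt (R v) (allFin n)                            ≡⟨ count-cnt (R v) ⟨
    classSize R v                                   ∎
    where open ≡-Reasoning

  -- Equitability replaces `u` by the fixed member `u₀` of its class, which makes the degree
  -- constant on the class.
  degree : ∀ {u u₀} w₀ (E : V → Bool) p q r s → R u u₀ ≡ true →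
    (∀ {w} → E w ≡ adj G u w ∧ (χE u w ≡ᵇ χE p q) ∧ (χE w u ≡ᵇ χE r s)) →
    cnt E (members (representative w₀)) ≡ mult G χE R u₀ w₀ p q r s
  degree {u} {u₀} w₀ E p q r s Ruu₀ E≗ = begin
    cnt E (members (representative w₀))   ≡⟨ cnt-members E w₀ ⟩
    count (λ w → R w w₀ ∧ E w)            ≡⟨ count-cnt {n} _ ⟩
    cnt (λ w → R w w₀ ∧ E w) (allFin n)   ≡⟨ cnt-cong (allFin n) (λ {w} →
                                               ≡-trans (cong (R w w₀ ∧_) E≗) (∧-left-comm (R w w₀) (adj G u w) ((χE u w ≡ᵇ χE p q) ∧ (χE w u ≡ᵇ χE r s)))) ⟩
    cnt _ (allFin n)                      ≡⟨ count-cnt {n} _ ⟨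
    mult G χE R u w₀ p q r s              ≡⟨ equitable Ruu₀ w₀ p q r s ⟩
    mult G χE R u₀ w₀ p q r s             ∎
    where
    open ≡-Reasoning
    ∧-left-comm : ∀ a b c → a ∧ (b ∧ c) ≡ b ∧ (a ∧ c)
    ∧-left-comm true  b     c = ≡-refl
    ∧-left-comm false true  c = ≡-refl
    ∧-left-comm false false c = ≡-refl

  -- The edges whose arc colours agree with those of u₀w₀ form a biregular graph.
  normalized-matching : ∀ {u₀ w₀} → adj G u₀ w₀ ≡ true →
                        NormalizedMatching (representative u₀) (representative w₀)
  normalized-matching {u₀} {w₀} u₀w₀ X Y XY = biregular E _ _
    (λ {u} i → degree w₀ (E u) u₀ w₀ w₀ u₀ (representative-injective (∈-members⁻ i)) ≡-refl)
    (λ {w} i → degree u₀ (λ u → E u w) w₀ u₀ u₀ w₀ (representative-injective (∈-members⁻ i)) λ {u} →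
      ≡-trans (cong (λ b → b ∧ (χE u w ≡ᵇ χE u₀ w₀) ∧ (χE w u ≡ᵇ χE w₀ u₀)) (Graph.sym G u w))
              (cong (adj G w u ∧_) (∧-comm (χE u w ≡ᵇ χE u₀ w₀) _)))
    -- The degree is positive because `w₀` itself is counted for `u₀`.
    (subst (0 <_) (≡-sym (count-cnt {n} _)) (cnt-positive _ (∈-allFin w₀)
      (∧₄-intro u₀w₀ (reflexive w₀) (≡ᵇ-refl (χE u₀ w₀)) (≡ᵇ-refl (χE w₀ u₀)))))
    X Y (λ i j Xu e → XY (∈-members⁻ i) (∈-members⁻ j) Xu (proj₁ (∧-true e)))
    where
    E : V → V → Bool
    E u w = adj G u w ∧ (χE u w ≡ᵇ χE u₀ w₀) ∧ (χE w u ≡ᵇ χE w₀ u₀)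

  -- By equitability `z′` has a neighbour in the class of `v`, and a class of size at most `t` has
  -- no element besides `v`.
  adjacent-class : ∀ {z z′ v} → classSize R v ≤ t → adj G z v ≡ true → R z z′ ≡ true →
                   adj G z′ v ≡ true
  adjacent-class {z} {z′} {v} small zv Rzz′
    with cnt-witness _ (allFin n) (subst (0 <_) (≡-trans (equitable Rzz′ v z v v z) (count-cnt {n} _))
      (subst (0 <_) (≡-sym (count-cnt {n} _)) (cnt-positive _ (∈-allFin v)
        (∧₄-intro zv (reflexive v) (≡ᵇ-refl (χE z v)) (≡ᵇ-refl (χE v z))))))
  ... | u , _ , p with ∧₄-elim {adj G z′ u} {R u v} {χE z′ u ≡ᵇ χE z v} {χE u z′ ≡ᵇ χE v z} p
  ...   | z′u , Ruv , _ with singleton small (symmetric Ruv)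
  ...     | ≡-refl = z′u

  large : ∀ {v} → classSize R v ≢ 1 → t < classSize R v
  large {v} not-one with classSize R v ≤? t
  ... | no  ≰t = ≰⇒> ≰t
  ... | yes ≤t = contradiction (≤-antisym at-most at-least) not-one
    where
    at-most : classSize R v ≤ 1
    at-most = ≤-trans (≤-reflexive (count-cnt (R v)))
      (cnt-⊆ {q = λ _ → true} (v ∷ []) (Unique.allFin⁺ n) λ _ Rvw →
        here (≡-sym (singleton ≤t Rvw)) , ≡-refl)
    at-least : 1 ≤ classSize R v
    at-least = subst (0 <_) (≡-sym (count-cnt (R v))) (cnt-positive (R v) (∈-allFin v) (reflexive v))

-- The topological clique and the bound on the neighbourhood.

-- The path for the pair `(i , j)` runs inside the member with index `combine i j`, so different
-- pairs use disjoint members. Members lie in large classes and branch vertices in small ones, so no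
-- path meets a branch vertex in its interior.
subdivision : ∀ {n} (G : Graph n) {κ τ h} (v : Fin h → Fin n) → (∀ i j → v i ≡ v j → i ≡ j) →
  (ys : Fin h → Fin n) → (∀ {i a} → κ a ≡ ys i → adj G a (v i) ≡ true) →
  (∀ i → ¬ (τ < Colours.size (adj G) κ τ (κ (v i)))) →
  Families.Family (adj G) (Graph.sym G) κ τ (h * h) ys → TopKSub G h
subdivision {n} G {κ} {τ} {h} v v-injective ys attached small family = record
  { branch      = v
  ; branch-inj  = v-injective
  ; len         = λ i j → length (inner i j ++ v j ∷ [])
  ; path        = λ i j → lookup (vertices i j)
  ; path-start  = λ _ _ _ → ≡-refl
  ; path-end    = λ i j _ → lookup-end (path i j)
  ; path-edge   = λ i j _ → lookup-step (path i j)
  ; path-inj    = λ i j i<j → lookup-injective (unique i<j)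
  ; path-branch = λ i j _ k l eq → on-branch {i} {j} (lookup-∈ (vertices i j) k) eq
  ; path-disj   = λ i j i′ j′ _ _ distinct k k′ eq → apart distinct
      (locate (lookup-∈ (vertices i j) k)) (locate (lookup-∈ (vertices i′ j′) k′)) eq
  }
  where
  open Families.Family family

  inner : Fin h → Fin h → List (Fin n)
  inner i j = let a , l , _ = join (combine i j) i j in a ∷ l

  vertices : Fin h → Fin h → List (Fin n)
  vertices i j = v i ∷ inner i j ++ v j ∷ []

  path : ∀ i j → Path (λ u w → adj G u w ≡ true) (v i) (inner i j ++ v j ∷ []) (v j)
  path i j = let a , l , b , κa , κb , p , _ = join (combine i j) i j in
    ≡-trans (Graph.sym G (v i) a) (attached κa) ∷ snoc p (attached κb)

  member : ∀ {i j x} → x ∈ inner i j → Member (combine i j) x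
  member {i} {j} x∈ = let _ , _ , _ , _ , _ , _ , _ , members = join (combine i j) i j in
    All.lookup members x∈

  branch∉inner : ∀ {i j} k → v k ∉ inner i j
  branch∉inner k k∈ = small k (big (member k∈))

  unique : ∀ {i j} → i <ᶠ j → Unique (vertices i j)
  unique {i} {j} i<j = let _ , _ , _ , _ , _ , _ , u , _ = join (combine i j) i j in
    unique-∷ first∉ (Unique.++⁺ u ([] ∷ []) λ { (x∈ , here ≡-refl) → branch∉inner j x∈ })
    where
    open Colours (adj G) κ τ using (unique-∷)
    first∉ : v i ∉ inner i j ++ v j ∷ []
    first∉ x∈ with ∈-++⁻ (inner i j) x∈
    ... | inj₁ x∈inner     = branch∉inner i x∈inner
    ... | inj₂ (here vi≡vj) = <-irrefl (cong toℕ (v-injective i j vi≡vj)) i<j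

  locate : ∀ {i j x} → x ∈ vertices i j → (∃ λ k → (k ≡ i ⊎ k ≡ j) × x ≡ v k) ⊎ x ∈ inner i j
  locate {i} (here eq) = inj₁ (i , inj₁ ≡-refl , eq)
  locate {i} {j} (there x∈) with ∈-++⁻ (inner i j) x∈
  ... | inj₁ x∈inner   = inj₂ x∈inner
  ... | inj₂ (here eq) = inj₁ (j , inj₂ ≡-refl , eq)

  on-branch : ∀ {i j x l} → x ∈ vertices i j → x ≡ v l → l ≡ i ⊎ l ≡ j
  on-branch {i} {j} {x} {l} x∈ ≡-refl with locate {i} {j} x∈
  ... | inj₂ l∈ = contradiction l∈ (branch∉inner l)
  ... | inj₁ (k , end , vl≡vk) with v-injective l k vl≡vk
  ...   | ≡-refl = end

  apart : ∀ {i j i′ j′ x x′} → ¬ (i ≡ i′ × j ≡ j′) →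
    (∃ λ k → (k ≡ i ⊎ k ≡ j) × x ≡ v k) ⊎ x ∈ inner i j →
    (∃ λ k → (k ≡ i′ ⊎ k ≡ j′) × x′ ≡ v k) ⊎ x′ ∈ inner i′ j′ →
    x ≡ x′ → Σ (Fin h) λ l → x ≡ v l
  apart distinct (inj₁ (k , _ , eq)) _ _              = k , eq
  apart distinct (inj₂ _) (inj₁ (k , _ , eq)) x≡x′     = k , ≡-trans x≡x′ eq
  apart {i} {j} {i′} {j′} distinct (inj₂ x∈) (inj₂ x∈′) ≡-refl =
    contradiction (combine-injective i j i′ j′ (disjoint (member {i} {j} x∈) (member {i′} {j′} x∈′))) distinct

enumerate : ∀ {n h} (p : Fin n → Bool) → h ≤ count p →
            ∃ λ (v : Fin h → Fin n) → (∀ i → p (v i) ≡ true) × (∀ i j → v i ≡ v j → i ≡ j)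
enumerate {n} {h} p h≤ = v , p-v , λ i j eq →
  inject≤-injective h≤length h≤length i j (lookup-injective unique _ _ eq)
  where
  chosen : List (Fin n)
  chosen = filter (λ x → p x ≟ᵇ true) (allFin n)
  unique : Unique chosen
  unique = Unique.filter⁺ (λ x → p x ≟ᵇ true) (Unique.allFin⁺ n)
  h≤length : h ≤ length chosen
  h≤length = ≤-trans h≤ (≤-trans (≤-reflexive (count-cnt p)) (≤-trans
    (cnt-⊆ {q = λ _ → true} chosen (Unique.allFin⁺ n) λ i px → ∈-filter⁺ (λ x → p x ≟ᵇ true) i px , ≡-refl)
    (≤-reflexive (cnt-true chosen))))
  v : Fin h → Fin n
  v i = lookup chosen (inject≤ i h≤length)
  p-v : ∀ i → p (v i) ≡ true
  p-v i = proj₂ (∈-filter⁻ (λ x → p x ≟ᵇ true) {xs = allFin n} (lookup-∈ chosen (inject≤ i h≤length)))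

large-neighbourhood : ∀ {n} (G : Graph n) (χE : Fin n → Fin n → ℕ) {h t} {R : Coloring n} →
  Refinement.IsClosed G χE t R → 3 * h ^ 3 ≤ t → (Z : Subset n) → IsComponent G (singletons R) Z →
  h ≤ count (nbhd G Z) → TopKSub G h
large-neighbourhood G χE {zero} _ _ _ _ _ = record
  { branch = λ () ; branch-inj = λ () ; len = λ () ; path = λ () ; path-start = λ () ; path-end = λ ()
  ; path-edge = λ () ; path-inj = λ () ; path-branch = λ () ; path-disj = λ () }
large-neighbourhood {n} G χE {suc h} {t} {R} isClosed bound Z (_ , outside , connected , maximal) many =
  subdivision G v v-injective (λ i → representative (z i)) attached
    (λ i big → <⇒≱ (subst (t <_) (size-class (v i)) big) (small i))
    (family h (λ i → representative (z i)) ≡-refl (large-Z (Zz zero))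
      (λ i → walk (connected (z zero) (z i) (Zz zero) (Zz i)))
      -- For a clique on h + 1 vertices the requirement is (3h + 1)(h + 1)² ≤ 3(h + 1)³ ≤ t.
      (suc h * suc h) (≤-trans (≤-trans (*-monoˡ-≤ (suc h * suc h) cost≤) (≤-reflexive cube)) bound))
  where
  open ClosedColoring G χE isClosed
  open Families (adj G) (Graph.sym G) representative t using (family)

  chosen : ∃ λ (v : Fin (suc h) → Fin n) → (∀ i → nbhd G Z (v i) ≡ true) × (∀ i j → v i ≡ v j → i ≡ j)
  chosen = enumerate (nbhd G Z) many

  v : Fin (suc h) → Fin n
  v = proj₁ chosen

  v-injective : ∀ i j → v i ≡ v j → i ≡ j
  v-injective = proj₂ (proj₂ chosen)

  contact : ∀ i → ∃ λ z → Z z ∧ adj G z (v i) ≡ true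
  contact i = anyV-elim (proj₂ (∧-true (proj₁ (proj₂ chosen) i)))

  z : Fin (suc h) → Fin n
  z i = proj₁ (contact i)

  Zz : ∀ i → Z (z i) ≡ true
  Zz i = proj₁ (∧-true (proj₂ (contact i)))

  zv : ∀ i → adj G (z i) (v i) ≡ true
  zv i = proj₂ (∧-true {Z (z i)} (proj₂ (contact i)))

  -- A neighbour of `Z` outside `D` would belong to `Z` by maximality, so the class of `v i` is a
  -- singleton; and 1 ≤ t by the hypothesis on `t`.
  small : ∀ i → classSize R (v i) ≤ t
  small i with true-or-false (singletons R (v i))
  ... | inj₁ single = subst (_≤ t) (≡-sym (≡ᵇ-sound single))
    (≤-trans (≤-trans (s≤s z≤n) (m≤m*n 3 (suc h ^ 3) {{m^n≢0 (suc h) 3}})) bound)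
  ... | inj₂ D = ⊥-elim (false≢true (not-true (proj₁ (∧-true (proj₁ (proj₂ chosen) i))))
    (maximal (z i) (v i) (Zz i) (zv i) D))

  large-Z : ∀ {x} → Z x ≡ true → t < size (representative x)
  large-Z {x} Zx = subst (t <_) (≡-sym (size-class x)) (large λ one →
    false≢true (outside x Zx) (subst (λ k → (k ≡ᵇ 1) ≡ true) (≡-sym one) ≡-refl))

  attached : ∀ {i a} → representative a ≡ representative (z i) → adj G a (v i) ≡ true
  attached {i} {a} eq = adjacent-class (small i) (zv i) (representative-injective (≡-sym eq))

  -- Edges inside `Z` project to steps between classes; a class meeting `Z` is large because `Z`
  -- avoids the singleton classes.
  walk : ∀ {x y} → Reach G Z x y → Star _⇝_ (representative x) (representative y)
  walk here           = ε
  walk (step xw Zw r) = (normalized-matching xw , large-Z Zw) ◅ walk r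

  cost≤ : h * 3 + 1 ≤ 3 * suc h
  cost≤ = begin
    h * 3 + 1 ≡⟨ cong (_+ 1) (*-comm h 3) ⟩
    3 * h + 1 ≤⟨ +-monoʳ-≤ (3 * h) (s≤s z≤n) ⟩
    3 * h + 3 ≡⟨ +-comm (3 * h) 3 ⟩
    3 + 3 * h ≡⟨ *-suc 3 h ⟨
    3 * suc h ∎
    where open ≤-Reasoning

  cube : 3 * suc h * (suc h * suc h) ≡ 3 * suc h ^ 3
  cube = ≡-trans (*-assoc 3 (suc h) _)
    (cong (λ k → 3 * (suc h * (suc h * k))) (≡-sym (*-identityʳ (suc h))))

component-cong : ∀ {n} {G : Graph n} {D D′ Z : Subset n} → (∀ v → D v ≡ D′ v) →
                 IsComponent G D Z → IsComponent G D′ Z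
component-cong D≗D′ (nonempty , outside , connected , maximal) =
  nonempty , (λ v Zv → ≡-trans (≡-sym (D≗D′ v)) (outside v Zv)) , connected
  , λ u v Zu uv D′v → maximal u v Zu uv (≡-trans (D≗D′ v) D′v)

theorem4p1 : ∀ {n} (G : Graph n) (χV : Fin n → ℕ) (χE : Fin n → Fin n → ℕ)
    (h : ℕ) → ¬ TopKSub G h →
    (X : Subset n) (t : ℕ) → 3 * h ^ 3 ≤ t →
    (c : ℕ → Coloring n) → IsClosureSeq G χV χE X t c →
    (i : ℕ) → IsStableIndex c i →
    (Z : Subset n) → IsComponent G (singletons (c i)) Z →
    count (nbhd G Z) < h
theorem4p1 {n} G χV χE h no-subdivision X t bound c closure i stable Z component =
  ≰⇒> λ many → no-subdivision
    (large-neighbourhood G χE (Refinement.closed G χE {χV} {X} {t} {c} closure i stable) bound Z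
      (component-cong same-singletons component) many)
  where
  i≤ : i ≤ suc (2 * i)
  i≤ = ≤-trans (m≤m+n i _) (n≤1+n _)
  -- The component refers to `c i`, the closed colouring is taken at the odd index; beyond the
  -- stable index both induce the same partition.
  same-singletons : ∀ v → singletons (c i) v ≡ singletons (c (suc (2 * i))) v
  same-singletons v = cong (_≡ᵇ 1) (begin
    count (c i v)                         ≡⟨ count-cnt (c i v) ⟩
    cnt (c i v) (allFin n)                ≡⟨ cnt-cong (allFin n) (samePart-elim (c i) (c (suc (2 * i))) (stable _ i≤) v _) ⟩
    cnt (c (suc (2 * i)) v) (allFin n)    ≡⟨ count-cnt (c (suc (2 * i)) v) ⟨
    count (c (suc (2 * i)) v)             ∎)
    where open ≡-Reasoning
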